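{- Let $N\ge2$ be even, $M_2=N/2$, and let $a$ be odd. The linear code over $\mathbb{Z}_N$ generated by the rows of $$g=\begin{pmatrix} M_2 & M_2 & 0 & 0 & 0 \\ {} M_2 & 0 & M_2 & 1 & -1 \\ 0 & 0 & 0 & a & -a \end{pmatrix}$$ is isomorphic to the code generated by the rows of $$g_0=\begin{pmatrix} M_2 & M_2 & 0 & 0 & 0 \\ {} M_2 & 0 & M_2 & 0 & 0 \\ 0 & 0 & 0 & 1 & -1 \end{pmatrix}.$$ This is a direct sum; in particular, the corresponding simplex is a free join of $2\Delta_2$ and a $1$-dimensional interval of length $N$.
   Context: $\mathbb{Z}_N=\mathbb{Z}/N\mathbb{Z}$. A linear code of length $n$ over $\mathbb{Z}_N$ is a submodule of $\mathbb{Z}_N^n$. Two codes over the same $\mathbb{Z}_N$ and of the same length are isomorphic if they coincide after a permutation of coordinates. Direct sum: for codes $C_1$ over $\mathbb{Z}_{N_1}$ and $C_2$ over $\mathbb{Z}_{N_2}$, with $L=\operatorname{lcm}(N_1,N_2)$, $C_1\oplus C_2$ is the code over $\mathbb{Z}_L$ consisting of all concatenations $\frac{L}{N_1}c_1\,|\,\frac{L}{N_2}c_2$, $c_i\in C_i$. Simplex of a code: for a code $C\subseteq\mathbb{Z}_N^{d+1}$ all of whose words have coordinate sum $0\bmod N$, let $M=\pi^{ -1}(C)\subseteq\mathbb{Z}^{d+1}$ with $\pi:\mathbb{Z}^{d+1}\to\mathbb{Z}_N^{d+1}$ the reduction map; the corresponding simplex is $\operatorname{conv}(Ne_0,\dots,Ne_d)$,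 viewed as a lattice simplex with respect to the affine lattice $\operatorname{aff}(Ne_0,\dots,Ne_d)\cap M$. Lattice simplices are considered up to affine unimodular isomorphism. $2\Delta_2=\operatorname{conv}\{(0,0),(2,0),(0,2)\}\subset\mathbb{R}^2$. The free join of lattice polytopes $\Delta_1,\Delta_2$ of dimensions $d_1,d_2$ is $\operatorname{conv}(\Delta_1\times\{0^{d_2}\}\times\{0\},\ \{0^{d_1}\}\times\Delta_2\times\{1\})\subset\mathbb{R}^{d_1+d_2+1}$. -}

module Defs where

open import Algebra.Apartness.Bundles using (HeytingField; HeytingCommutativeRing)
open import Algebra.Bundles using (CommutativeRing)
import Algebra.Definitions.RawMonoid as RawMonoidDefs
import Algebra.Properties.Semiring.Sum as SemiringSum
open import Data.Bool.Base using (if_then_else_)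
open import Data.Fin.Base using (Fin; splitAt)
open import Data.Fin.Permutation using (Permutation′; _⟨$⟩ʳ_)
open import Data.Fin.Properties using (_≟_)
open import Data.Integer.Base as ℤ using (ℤ; +_; -[1+_]; 0ℤ; 1ℤ; -1ℤ)
open import Data.Integer.Divisibility.Signed using (_∣_; divides)
import Data.Integer.Properties as ℤₚ
open import Data.Integer.Tactic.RingSolver using (solve-∀)
open import Data.Nat.Base as ℕ using (ℕ; suc)
open import Data.Nat.Divisibility using (quotient)
open import Data.Nat.LCM using (lcm; m∣lcm[m,n]; n∣lcm[m,n])
open import Data.Product.Base using (_×_; _,_; ∃-syntax; Σ-syntax)
open import Data.Sum.Base using (_⊎_; inj₁; inj₂; [_,_])
open import Data.Vec.Functional
  using (Vector; []; _∷_; _++_; map; rearrange; replicate; zipWith)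
open import Function.Bundles using (_⇔_)
open import Level using (Level; _⊔_; 0ℓ) renaming (suc to lsuc)
open import Relation.Binary.Core using (Rel)
open import Relation.Binary.PropositionalEquality
  using (_≡_; refl; sym; trans; cong; cong₂; subst)
open import Relation.Binary.Structures using (IsStrictPartialOrder)
open import Relation.Nullary.Decidable.Core using (does)
open import Relation.Nullary.Negation using (¬_)
open import Relation.Unary using (Pred; _∈_; _∪_)

-- The ring ℤ/Nℤ, as the setoid of integers modulo N.  In particular the
-- reduction map ℤ → ℤ/Nℤ is the identity on carriers.

module _ (N : ℕ) where

  infix 4 _≡ₘ_

  _≡ₘ_ : Rel ℤ 0ℓ
  x ≡ₘ y = + N ∣ (x ℤ.- y)

  private
    n : ℤ
    n = + N

    reflexiveₘ : ∀ {x y} → x ≡ y → x ≡ₘ y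
    reflexiveₘ {x} refl = divides 0ℤ (ℤₚ.+-inverseʳ x)

    symₘ : ∀ {x y} → x ≡ₘ y → y ≡ₘ x
    symₘ {x} {y} (divides q e) =
      divides (ℤ.- q) (trans (flip x y) (trans (cong ℤ.-_ e) (neg q n)))
      where
      flip : ∀ x y → y ℤ.- x ≡ ℤ.- (x ℤ.- y)
      flip = solve-∀
      neg : ∀ q n → ℤ.- (q ℤ.* n) ≡ (ℤ.- q) ℤ.* n
      neg = solve-∀

    transₘ : ∀ {x y z} → x ≡ₘ y → y ≡ₘ z → x ≡ₘ z
    transₘ {x} {y} {z} (divides q e) (divides r f) =
      divides (q ℤ.+ r) (trans (split x y z) (trans (cong₂ ℤ._+_ e f) (merge q r n)))
      where
      split : ∀ x y z → x ℤ.- z ≡ (x ℤ.- y) ℤ.+ (y ℤ.- z)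
      split = solve-∀
      merge : ∀ q r n → q ℤ.* n ℤ.+ r ℤ.* n ≡ (q ℤ.+ r) ℤ.* n
      merge = solve-∀

    +-congₘ : ∀ {x y u v} → x ≡ₘ y → u ≡ₘ v → (x ℤ.+ u) ≡ₘ (y ℤ.+ v)
    +-congₘ {x} {y} {u} {v} (divides q e) (divides r f) =
      divides (q ℤ.+ r) (trans (split x y u v) (trans (cong₂ ℤ._+_ e f) (merge q r n)))
      where
      split : ∀ x y u v → (x ℤ.+ u) ℤ.- (y ℤ.+ v) ≡ (x ℤ.- y) ℤ.+ (u ℤ.- v)
      split = solve-∀
      merge : ∀ q r n → q ℤ.* n ℤ.+ r ℤ.* n ≡ (q ℤ.+ r) ℤ.* n
      merge = solve-∀

    *-congₘ : ∀ {x y u v} → x ≡ₘ y → u ≡ₘ v → (x ℤ.* u) ≡ₘ (y ℤ.* v)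
    *-congₘ {x} {y} {u} {v} (divides q e) (divides r f) =
      divides (q ℤ.* u ℤ.+ y ℤ.* r)
        (trans (split x y u v)
          (trans (cong₂ (λ s t → s ℤ.* u ℤ.+ y ℤ.* t) e f) (merge q r n u y)))
      where
      split : ∀ x y u v →
              x ℤ.* u ℤ.- y ℤ.* v ≡ (x ℤ.- y) ℤ.* u ℤ.+ y ℤ.* (u ℤ.- v)
      split = solve-∀
      merge : ∀ q r n u y → (q ℤ.* n) ℤ.* u ℤ.+ y ℤ.* (r ℤ.* n) ≡
                            (q ℤ.* u ℤ.+ y ℤ.* r) ℤ.* n
      merge = solve-∀

    -‿congₘ : ∀ {x y} → x ≡ₘ y → (ℤ.- x) ≡ₘ (ℤ.- y)
    -‿congₘ {x} {y} (divides q e) =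
      divides (ℤ.- q) (trans (flip x y) (trans (cong ℤ.-_ e) (neg q n)))
      where
      flip : ∀ x y → (ℤ.- x) ℤ.- (ℤ.- y) ≡ ℤ.- (x ℤ.- y)
      flip = solve-∀
      neg : ∀ q n → ℤ.- (q ℤ.* n) ≡ (ℤ.- q) ℤ.* n
      neg = solve-∀

  ℤ/ : CommutativeRing 0ℓ 0ℓ
  ℤ/ = record
    { Carrier = ℤ
    ; _≈_ = _≡ₘ_
    ; _+_ = ℤ._+_
    ; _*_ = ℤ._*_
    ; -_ = ℤ.-_
    ; 0# = 0ℤ
    ; 1# = 1ℤ
    ; isCommutativeRing = record
      { isRing = record
        { +-isAbelianGroup = record
          { isGroup = record
            { isMonoid = record
              { isSemigroup = record
                { isMagma = record
                  { isEquivalence = record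
                    { refl = λ {x} → reflexiveₘ {x} refl
                    ; sym = λ {x} {y} → symₘ {x} {y}
                    ; trans = λ {x} {y} {z} → transₘ {x} {y} {z}
                    }
                  ; ∙-cong = λ {x} {y} {u} {v} → +-congₘ {x} {y} {u} {v}
                  }
                ; assoc = λ x y z → reflexiveₘ (ℤₚ.+-assoc x y z)
                }
              ; identity = (λ x → reflexiveₘ (ℤₚ.+-identityˡ x))
                         , (λ x → reflexiveₘ (ℤₚ.+-identityʳ x))
              }
            ; inverse = (λ x → reflexiveₘ (ℤₚ.+-inverseˡ x))
                      , (λ x → reflexiveₘ (ℤₚ.+-inverseʳ x))
            ; ⁻¹-cong = λ {x} {y} → -‿congₘ {x} {y}
            }
          ; comm = λ x y → reflexiveₘ (ℤₚ.+-comm x y)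
          }
        ; *-cong = λ {x} {y} {u} {v} → *-congₘ {x} {y} {u} {v}
        ; *-assoc = λ x y z → reflexiveₘ (ℤₚ.*-assoc x y z)
        ; *-identity = (λ x → reflexiveₘ (ℤₚ.*-identityˡ x))
                     , (λ x → reflexiveₘ (ℤₚ.*-identityʳ x))
        ; distrib = (λ x y z → reflexiveₘ (ℤₚ.*-distribˡ-+ x y z))
                  , (λ x y z → reflexiveₘ (ℤₚ.*-distribʳ-+ x y z))
        }
      ; *-comm = λ x y → reflexiveₘ (ℤₚ.*-comm x y)
      }
    }

module _ {c ℓ} (R : CommutativeRing c ℓ) where

  private
    module R = CommutativeRing R
  open SemiringSum R.semiring using (sum; sum-cong-≋; ∑-distrib-+; *-distribˡ-sum)

  record Submodule (n : ℕ) : Set (lsuc (c ⊔ ℓ)) where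
    field
      ⟦_⟧      : Pred (Vector R.Carrier n) (c ⊔ ℓ)
      resp     : ∀ {x y} → (∀ i → x i R.≈ y i) → x ∈ ⟦_⟧ → y ∈ ⟦_⟧
      0-closed : replicate n R.0# ∈ ⟦_⟧
      +-closed : ∀ {x y} → x ∈ ⟦_⟧ → y ∈ ⟦_⟧ → zipWith R._+_ x y ∈ ⟦_⟧
      *-closed : ∀ r {x} → x ∈ ⟦_⟧ → map (r R.*_) x ∈ ⟦_⟧

  span : ∀ {k n} → Vector (Vector R.Carrier n) k → Submodule n
  span {k} {n} g = record
    { ⟦_⟧      = λ x → ∃[ t ] (∀ j → x j R.≈ comb t j)
    ; resp     = λ { x≈y (t , e) → t , λ j → R.trans (R.sym (x≈y j)) (e j) }
    ; 0-closed = replicate k R.0# , λ j →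
        R.trans (R.sym (R.zeroˡ (comb (replicate k R.0#) j)))
          (R.trans (*-distribˡ-sum R.0# (λ i → R.0# R.* g i j))
            (sum-cong-≋ λ i → R.trans (R.sym (R.*-assoc R.0# R.0# (g i j)))
              (R.*-congʳ (R.zeroˡ R.0#))))
    ; +-closed = λ { (t , e) (u , f) → zipWith R._+_ t u , λ j →
        R.trans (R.+-cong (e j) (f j))
          (R.trans (R.sym (∑-distrib-+ (λ i → t i R.* g i j) (λ i → u i R.* g i j)))
            (sum-cong-≋ λ i → R.sym (R.distribʳ (g i j) (t i) (u i)))) }
    ; *-closed = λ { r (t , e) → map (r R.*_) t , λ j →
        R.trans (R.*-congˡ (e j))
          (R.trans (*-distribˡ-sum r (λ i → t i R.* g i j))
            (sum-cong-≋ λ i → R.sym (R.*-assoc r (t i) (g i j)))) }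
    }
    where
    comb : Vector R.Carrier k → Vector R.Carrier n
    comb t j = sum (λ i → t i R.* g i j)

open Submodule public using (⟦_⟧)

Code : ℕ → ℕ → Set₁
Code N n = Submodule (ℤ/ N) n

infix 4 _≅_

_≅_ : ∀ {N n} → Code N n → Code N n → Set
_≅_ {n = n} C D = Σ[ σ ∈ Permutation′ n ]
  (∀ x → x ∈ ⟦ C ⟧ ⇔ rearrange (σ ⟨$⟩ʳ_) x ∈ ⟦ D ⟧)

module _ {N₁ N₂ m n : ℕ} where

  private
    L : ℕ
    L = lcm N₁ N₂

    open CommutativeRing (ℤ/ L) using (_≈_) renaming
      (reflexive to ≈-reflexive; sym to ≈-sym; trans to ≈-trans;
       +-cong to ≈-+-cong; *-cong to ≈-*-cong; refl to ≈-refl)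

    -- The cofactors L/N₁ and L/N₂, read off from N₁ ∣ L and N₂ ∣ L.
    q₁ q₂ : ℤ
    q₁ = + quotient (m∣lcm[m,n] N₁ N₂)
    q₂ = + quotient (n∣lcm[m,n] N₁ N₂)

    concatenate : Vector ℤ m → Vector ℤ n → Vector ℤ (m ℕ.+ n)
    concatenate c₁ c₂ = map (q₁ ℤ.*_) c₁ ++ map (q₂ ℤ.*_) c₂

    concatenate-0 : ∀ i → 0ℤ ≡ concatenate (replicate m 0ℤ) (replicate n 0ℤ) i
    concatenate-0 i with splitAt m i
    ... | inj₁ _ = sym (ℤₚ.*-zeroʳ q₁)
    ... | inj₂ _ = sym (ℤₚ.*-zeroʳ q₂)

    concatenate-+ : ∀ c₁ c₂ d₁ d₂ i →
      concatenate c₁ c₂ i ℤ.+ concatenate d₁ d₂ i ≡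
      concatenate (zipWith ℤ._+_ c₁ d₁) (zipWith ℤ._+_ c₂ d₂) i
    concatenate-+ c₁ c₂ d₁ d₂ i with splitAt m i
    ... | inj₁ j = sym (ℤₚ.*-distribˡ-+ q₁ (c₁ j) (d₁ j))
    ... | inj₂ j = sym (ℤₚ.*-distribˡ-+ q₂ (c₂ j) (d₂ j))

    swap : ∀ r q x → r ℤ.* (q ℤ.* x) ≡ q ℤ.* (r ℤ.* x)
    swap = solve-∀

    concatenate-* : ∀ r c₁ c₂ i →
      r ℤ.* concatenate c₁ c₂ i ≡
      concatenate (map (r ℤ.*_) c₁) (map (r ℤ.*_) c₂) i
    concatenate-* r c₁ c₂ i with splitAt m i
    ... | inj₁ j = swap r q₁ (c₁ j)
    ... | inj₂ j = swap r q₂ (c₂ j)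

  infixr 6 _⊕_

  _⊕_ : Code N₁ m → Code N₂ n → Code (lcm N₁ N₂) (m ℕ.+ n)
  C₁ ⊕ C₂ = record
    { ⟦_⟧ = λ w → ∃[ c₁ ] ∃[ c₂ ] c₁ ∈ ⟦ C₁ ⟧ × c₂ ∈ ⟦ C₂ ⟧ ×
              (∀ i → w i ≈ concatenate c₁ c₂ i)
    ; resp = λ { {x} {y} x≈y (c₁ , c₂ , p₁ , p₂ , e) →
        c₁ , c₂ , p₁ , p₂ ,
        λ i → ≈-trans {y i} {x i} (≈-sym {x i} {y i} (x≈y i)) (e i) }
    ; 0-closed = _ , _ , C₁.0-closed , C₂.0-closed ,
        λ i → ≈-reflexive (concatenate-0 i)
    ; +-closed = λ { {x} {y} (c₁ , c₂ , p₁ , p₂ , e) (d₁ , d₂ , r₁ , r₂ , f) →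
        _ , _ , C₁.+-closed p₁ r₁ , C₂.+-closed p₂ r₂ ,
        λ i → subst (x i ℤ.+ y i ≈_) (concatenate-+ c₁ c₂ d₁ d₂ i)
          (≈-+-cong {x i} {_} {y i} {_} (e i) (f i)) }
    ; *-closed = λ { r {x} (c₁ , c₂ , p₁ , p₂ , e) →
        _ , _ , C₁.*-closed r p₁ , C₂.*-closed r p₂ ,
        λ i → subst (r ℤ.* x i ≈_) (concatenate-* r c₁ c₂ i)
          (≈-*-cong {r} {r} {x i} {_} (≈-refl {r}) (e i)) }
    }
    where
    module C₁ = Submodule C₁
    module C₂ = Submodule C₂

ZeroSum : ∀ {N n} → Code N n → Set
ZeroSum {N} C = ∀ x → x ∈ ⟦ C ⟧ → sum x ≈ 0#
  where
  open CommutativeRing (ℤ/ N) using (_≈_; 0#; +-rawMonoid)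
  open RawMonoidDefs +-rawMonoid using (sum)

-- The library has no real numbers, so polytopes are taken over an
-- arbitrary ordered field K in place of ℝ.  The axioms are ones that ℝ
-- satisfies constructively: the strict order is primitive, and its weak
-- linearity follows from cotransitivity of _#_.

record OrderedField c ℓ₁ ℓ₂ ℓ₃ : Set (lsuc (c ⊔ ℓ₁ ⊔ ℓ₂ ⊔ ℓ₃)) where
  field
    heytingField : HeytingField c ℓ₁ ℓ₂

  open HeytingField heytingField public

  commutativeRing : CommutativeRing c ℓ₁
  commutativeRing = HeytingCommutativeRing.commutativeRing heytingCommutativeRing

  infix 4 _<_ _≤_

  field
    _<_                  : Rel Carrier ℓ₃
    isStrictPartialOrder : IsStrictPartialOrder _≈_ _<_
    <⇒#                  : ∀ {x y} → x < y → x # y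
    #⇒<⊎>                : ∀ {x y} → x # y → x < y ⊎ y < x
    +-monoˡ-<            : ∀ z {x y} → x < y → x + z < y + z
    *-pos                : ∀ {x y} → 0# < x → 0# < y → 0# < x * y

  _≤_ : Rel Carrier ℓ₃
  x ≤ y = ¬ (y < x)

module Geometry {c ℓ₁ ℓ₂ ℓ₃} (K : OrderedField c ℓ₁ ℓ₂ ℓ₃) where

  open OrderedField K using
    (Carrier; _≈_; _+_; _*_; -_; 0#; 1#; _≤_; commutativeRing)
  open CommutativeRing commutativeRing using (+-rawMonoid)
  open RawMonoidDefs +-rawMonoid using (sum) renaming (_×_ to _·_)

  Point : ℕ → Set c
  Point n = Vector Carrier n

  infix 4 _≋_

  _≋_ : ∀ {n} → Rel (Point n) ℓ₁
  x ≋ y = ∀ i → x i ≈ y i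

  ι : ℤ → Carrier
  ι (+ n)    = n · 1#
  ι -[1+ n ] = - (suc n · 1#)

  combination : ∀ {k n} → Vector Carrier k → Vector (Point n) k → Point n
  combination t p j = sum (λ i → t i * p i j)

  module _ {n : ℕ} {ℓ : Level} (S : Pred (Point n) ℓ) where

    aff : Pred (Point n) (c ⊔ ℓ₁ ⊔ ℓ)
    aff x = ∃[ k ] Σ[ p ∈ Vector (Point n) k ] Σ[ t ∈ Vector Carrier k ]
      (∀ i → p i ∈ S) × sum t ≈ 1# × x ≋ combination t p

    conv : Pred (Point n) (c ⊔ ℓ₁ ⊔ ℓ₃ ⊔ ℓ)
    conv x = ∃[ k ] Σ[ p ∈ Vector (Point n) k ] Σ[ t ∈ Vector Carrier k ]
      (∀ i → p i ∈ S) × (∀ i → 0# ≤ t i) × sum t ≈ 1# × x ≋ combination t p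

  range : ∀ {k n} → Vector (Point n) k → Pred (Point n) ℓ₁
  range v x = ∃[ i ] x ≋ v i

  ℤ^ : ∀ n → Pred (Point n) ℓ₁
  ℤ^ n x = Σ[ z ∈ Vector ℤ n ] x ≋ map ι z

  -- Isomorphism of lattice polytopes involves only these two sets, so no
  -- vertex description is stored.
  record LatticeBody (n : ℕ) : Set (lsuc (c ⊔ ℓ₁ ⊔ ℓ₃)) where
    field
      lattice : Pred (Point n) (c ⊔ ℓ₁)
      body    : Pred (Point n) (c ⊔ ℓ₁ ⊔ ℓ₃)

  open LatticeBody

  record AffineMap (m n : ℕ) : Set c where
    field
      matrix      : Vector (Point m) n
      translation : Point n

    apply : Point m → Point n
    apply x i = sum (λ j → matrix i j * x j) + translation i

  open AffineMap

  -- Affine unimodular isomorphism.  The ambient maps are mutually inverse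
  -- on the lattices, hence also on their affine hulls, which contain the
  -- bodies; outside the hulls they are irrelevant.
  infix 4 _≅ᵤ_

  record _≅ᵤ_ {m n} (P : LatticeBody m) (Q : LatticeBody n)
              : Set (c ⊔ ℓ₁ ⊔ ℓ₃) where
    field
      to           : AffineMap m n
      from         : AffineMap n m
      to-lattice   : ∀ x → x ∈ lattice P → apply to x ∈ lattice Q
      from-lattice : ∀ y → y ∈ lattice Q → apply from y ∈ lattice P
      from∘to      : ∀ x → x ∈ lattice P → apply from (apply to x) ≋ x
      to∘from      : ∀ y → y ∈ lattice Q → apply to (apply from y) ≋ y
      to-body      : ∀ x → x ∈ body P → apply to x ∈ body Q
      from-body    : ∀ y → y ∈ body Q → apply from y ∈ body P

  scaledBasis : ∀ n → ℕ → Vector (Point n) n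
  scaledBasis n N i j = if does (i ≟ j) then ι (+ N) else 0#

  -- `z ∈ ⟦ C ⟧` for an integer vector z says that z lies in M = π⁻¹(C).
  simplex : ∀ {N d} (C : Code N (suc d)) → ZeroSum C → LatticeBody (suc d)
  simplex {N} {d} C _ = record
    { lattice = λ x → x ∈ aff Ne × Σ[ z ∈ Vector ℤ (suc d) ] z ∈ ⟦ C ⟧ × x ≋ map ι z
    ; body    = conv Ne
    }
    where
    Ne : Pred (Point (suc d)) ℓ₁
    Ne = range (scaledBasis (suc d) N)

  -- The factors are polytopes with respect to ℤ^d₁ and ℤ^d₂.
  freeJoin : ∀ {d₁ d₂} → Pred (Point d₁) (c ⊔ ℓ₁ ⊔ ℓ₃) →
             Pred (Point d₂) (c ⊔ ℓ₁ ⊔ ℓ₃) → LatticeBody (d₁ ℕ.+ d₂ ℕ.+ 1)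
  freeJoin {d₁} {d₂} Δ₁ Δ₂ = record
    { lattice = λ x → Level.Lift c (ℤ^ _ x)
    ; body    = conv (bottom ∪ top)
    }
    where
    bottom top : Pred (Point (d₁ ℕ.+ d₂ ℕ.+ 1)) (c ⊔ ℓ₁ ⊔ ℓ₃)
    bottom x = ∃[ u ] u ∈ Δ₁ × x ≋ (u ++ replicate d₂ 0#) ++ (0# ∷ [])
    top    x = ∃[ v ] v ∈ Δ₂ × x ≋ (replicate d₁ 0# ++ v) ++ (1# ∷ [])

  2Δ₂ : Pred (Point 2) (c ⊔ ℓ₁ ⊔ ℓ₃)
  2Δ₂ = conv (range (map (map ι) vertices))
    where
    vertices : Vector (Vector ℤ 2) 3
    vertices = (+ 0 ∷ + 0 ∷ [])
             ∷ (+ 2 ∷ + 0 ∷ [])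
             ∷ (+ 0 ∷ + 2 ∷ [])
             ∷ []

  interval : ℕ → Pred (Point 1) (c ⊔ ℓ₁ ⊔ ℓ₃)
  interval N = conv (range (map (map ι) ((+ 0 ∷ []) ∷ (+ N ∷ []) ∷ [])))

module _ (M₂ : ℤ) where

  g : ℤ → Vector (Vector ℤ 5) 3
  g a = (M₂ ∷ M₂ ∷ 0ℤ ∷ 0ℤ ∷ 0ℤ ∷ [])
      ∷ (M₂ ∷ 0ℤ ∷ M₂ ∷ 1ℤ ∷ -1ℤ ∷ [])
      ∷ (0ℤ ∷ 0ℤ ∷ 0ℤ ∷ a  ∷ ℤ.- a ∷ [])
      ∷ []

  g₀ : Vector (Vector ℤ 5) 3
  g₀ = (M₂ ∷ M₂ ∷ 0ℤ ∷ 0ℤ ∷ 0ℤ ∷ [])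
     ∷ (M₂ ∷ 0ℤ ∷ M₂ ∷ 0ℤ ∷ 0ℤ ∷ [])
     ∷ (0ℤ ∷ 0ℤ ∷ 0ℤ ∷ 1ℤ ∷ -1ℤ ∷ [])
     ∷ []

-- The two diagonal blocks of g₀; the first has entries in {0, N/2}, so it
-- is N/2 times a matrix over ℤ/2ℤ.

block₁ : Vector (Vector ℤ 3) 2
block₁ = (1ℤ ∷ 1ℤ ∷ 0ℤ ∷ [])
       ∷ (1ℤ ∷ 0ℤ ∷ 1ℤ ∷ [])
       ∷ []

block₂ : Vector (Vector ℤ 2) 1
block₂ = (1ℤ ∷ -1ℤ ∷ []) ∷ []

{-# OPTIONS --safe #-}

-- Since a = 1 + 2b and 2M₂ = N, the third row of g minus 2b times the second
-- is (0, 0, 0, 1, -1) modulo N, so g and g₀ span the same submodule C₀.  A vector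
-- x ∈ ℤ⁵ reduces into C₀ iff M₂ divides x₁ and x₂ and N divides x₀ + x₁ + x₂
-- and x₃ + x₄.  On the hyperplane Σ xᵢ = N this makes
-- (2x₁/N, 2x₂/N, x₄, (x₃ + x₄)/N) unimodular coordinates, and they take the
-- points N eᵢ to the vertices of the free join.

module Submission where

open import Defs
open import Algebra.Apartness.Properties.HeytingCommutativeRing
  using (1#0; x-0≈x; invertibleˡ⇒#; #-congʳ)
open import Algebra.Bundles using (CommutativeRing)
import Algebra.Properties.AbelianGroup as AbelianGroupProperties
import Algebra.Properties.Ring as RingProperties
import Algebra.Properties.Semiring.Mult as SemiringMult
import Algebra.Properties.Semiring.Sum as SemiringSum
import Algebra.Solver.Ring as RingSolver
open import Algebra.Solver.Ring.AlmostCommutativeRing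
  using (AlmostCommutativeRing; fromCommutativeRing; _-Raw-AlmostCommutative⟶_)
open import Data.Fin.Base using (Fin; zero; suc; _↑ˡ_; _↑ʳ_)
open import Data.Fin.Patterns using (0F; 1F; 2F; 3F; 4F)
open import Data.Fin.Permutation using () renaming (id to idₚ)
open import Data.Fin.Properties using (_≟_)
open import Data.Integer.Base as ℤ using (ℤ; +_; -[1+_]; 0ℤ; 1ℤ; -1ℤ)
import Data.Integer.DivMod as ℤ%
open import Data.Integer.Divisibility using () renaming (_∣_ to _∣ᶻ_)
open import Data.Integer.Divisibility.Signed using (divides; ∣⇒∣ᵤ)
import Data.Integer.Properties as ℤₚ
open import Data.Integer.Tactic.RingSolver using (solve-∀)
open import Data.Maybe.Base using () renaming (map to mapMaybe)
open import Data.Nat.Base as ℕ using (ℕ; zero; suc; s≤s; NonZero)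
import Data.Nat.DivMod as ℕ%
import Data.Nat.Divisibility as ℕ∣
open import Data.Nat.LCM using (lcm; m∣lcm[m,n]; n∣lcm[m,n]; lcm-least)
import Data.Nat.Properties as ℕₚ
open import Data.Product.Base using (_×_; _,_; ∃-syntax; Σ-syntax; proj₁; proj₂)
open import Data.Sum.Base using (inj₁; inj₂)
open import Data.Vec.Functional using (Vector; []; _∷_; _++_; map; replicate)
open import Function.Base using (_∘_; case_of_)
open import Function.Bundles using (mk⇔)
open import Level using (_⊔_; lift)
open import Relation.Binary.PropositionalEquality as ≡ using (_≡_; subst)
open import Relation.Binary.Structures using (IsStrictPartialOrder)
open import Relation.Nullary.Decidable using (yes; no; dec⇒maybe)
open import Relation.Nullary.Negation using (¬_; contradiction)
open import Relation.Unary using (Pred; _∈_; _⊆_; _≐_)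

open SemiringSum ℤₚ.+-*-semiring using () renaming (sum to sumℤ)

module Codes where

  open import Data.Integer.Base using (_+_; _*_; -_; _-_)
  open ≡ using (refl; sym; trans; cong; cong₂)

  odd⇒≡1+[b*2] : ∀ a → ¬ (+ 2 ∣ᶻ a) → ∃[ b ] a ≡ 1ℤ + b * + 2
  odd⇒≡1+[b*2] a 2∤a with a ℤ%.%ℕ 2 | ℤ%.a≡a%ℕn+[a/ℕn]*n a 2 | ℤ%.n%ℕd<d a 2
  ... | 0 | e | _ = contradiction
    (∣⇒∣ᵤ (divides (a ℤ%./ℕ 2) (trans e (ℤₚ.+-identityˡ _)))) 2∤a
  ... | 1 | e | _ = a ℤ%./ℕ 2 , e
  ... | suc (suc _) | _ | s≤s (s≤s ())

  subst-words : ∀ {L L′ n} (e : L ≡ L′) (D : Code L n) →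
                ⟦ subst (λ L → Code L n) e D ⟧ ≡ ⟦ D ⟧
  subst-words refl D = refl

  module _ {N : ℕ} where

    private
      infix 4 _≈_
      _≈_ : ℤ → ℤ → Set
      _≈_ = _≡ₘ_ N

    ≈-by : ∀ {n} → + N ≡ n → ∀ q {x y z} → x ≈ y → y ≡ z + q * n → x ≈ z
    ≈-by refl q {x} {y} {z} x≈y e = CommutativeRing.trans (ℤ/ N) {x} {y} {z} x≈y
      (divides q (trans (cong (_- z) e) (cancel z (q * + N))))
      where
      cancel : ∀ z w → z + w - z ≡ w
      cancel = solve-∀

    ≈-exactly : ∀ {x y z} → x ≈ y → y ≡ z → x ≈ z
    ≈-exactly {x} x≈y y≡z = subst (x ≈_) y≡z x≈y

  module EvenModulus (N M : ℕ) (N≡M*2 : N ≡ M ℕ.* 2) where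

    private
      m : ℤ
      m = + M

    n≡m*2 : + N ≡ + M * + 2
    n≡m*2 = trans (cong +_ N≡M*2) (ℤₚ.pos-* M 2)

    C₀ = span (ℤ/ N) (g₀ m)

    g⊆g₀ : ∀ a → ⟦ span (ℤ/ N) (g m a) ⟧ ⊆ ⟦ C₀ ⟧
    g⊆g₀ a {x} (t , e) = t′ , λ where
        0F → ≈-exactly {x = x 0F} (e 0F) (e₀ (t 0F) (t 1F) (t 2F) m a)
        1F → ≈-exactly {x = x 1F} (e 1F) (e₁ (t 0F) (t 1F) (t 2F) m a)
        2F → ≈-exactly {x = x 2F} (e 2F) (e₂ (t 0F) (t 1F) (t 2F) m a)
        3F → ≈-exactly {x = x 3F} (e 3F) (e₃ (t 0F) (t 1F) (t 2F) m a)
        4F → ≈-exactly {x = x 4F} (e 4F) (e₄ (t 0F) (t 1F) (t 2F) m a)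
      where
      t′ : Vector ℤ 3
      t′ = t 0F ∷ t 1F ∷ t 1F + t 2F * a ∷ []
      e₀ : ∀ t₀ t₁ t₂ m a → t₀ * m + (t₁ * m + (t₂ * 0ℤ + 0ℤ)) ≡
           t₀ * m + (t₁ * m + ((t₁ + t₂ * a) * 0ℤ + 0ℤ))
      e₀ = solve-∀
      e₁ : ∀ t₀ t₁ t₂ m a → t₀ * m + (t₁ * 0ℤ + (t₂ * 0ℤ + 0ℤ)) ≡
           t₀ * m + (t₁ * 0ℤ + ((t₁ + t₂ * a) * 0ℤ + 0ℤ))
      e₁ = solve-∀
      e₂ : ∀ t₀ t₁ t₂ m a → t₀ * 0ℤ + (t₁ * m + (t₂ * 0ℤ + 0ℤ)) ≡
           t₀ * 0ℤ + (t₁ * m + ((t₁ + t₂ * a) * 0ℤ + 0ℤ))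
      e₂ = solve-∀
      e₃ : ∀ t₀ t₁ t₂ m a → t₀ * 0ℤ + (t₁ * + 1 + (t₂ * a + 0ℤ)) ≡
           t₀ * 0ℤ + (t₁ * 0ℤ + ((t₁ + t₂ * a) * + 1 + 0ℤ))
      e₃ = solve-∀
      e₄ : ∀ t₀ t₁ t₂ m a → t₀ * 0ℤ + (t₁ * - + 1 + (t₂ * - a + 0ℤ)) ≡
           t₀ * 0ℤ + (t₁ * 0ℤ + ((t₁ + t₂ * a) * - + 1 + 0ℤ))
      e₄ = solve-∀

    g₀⊆g : ∀ a b → a ≡ 1ℤ + b * + 2 → ⟦ C₀ ⟧ ⊆ ⟦ span (ℤ/ N) (g m a) ⟧
    g₀⊆g _ b refl {x} (s , e) = t , λ where
        0F → ≈-by n≡m*2 (b * d) {x = x 0F} (e 0F) (e₀ (s 0F) (s 1F) (s 2F) m b)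
        1F → ≈-exactly {x = x 1F} (e 1F) (e₁ (s 0F) (s 1F) (s 2F) m b)
        2F → ≈-by n≡m*2 (b * d) {x = x 2F} (e 2F) (e₂ (s 0F) (s 1F) (s 2F) m b)
        3F → ≈-exactly {x = x 3F} (e 3F) (e₃ (s 0F) (s 1F) (s 2F) b)
        4F → ≈-exactly {x = x 4F} (e 4F) (e₄ (s 0F) (s 1F) (s 2F) b)
      where
      d : ℤ
      d = s 2F - s 1F
      -- t₁ ≡ s₁ modulo 2, and t₁ + a t₂ = s₂.
      t : Vector ℤ 3
      t = s 0F ∷ s 1F - + 2 * b * d ∷ d ∷ []
      e₀ : ∀ s₀ s₁ s₂ m b → s₀ * m + (s₁ * m + (s₂ * 0ℤ + 0ℤ)) ≡
           s₀ * m + ((s₁ - + 2 * b * (s₂ - s₁)) * m + ((s₂ - s₁) * 0ℤ + 0ℤ))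
             + b * (s₂ - s₁) * (m * + 2)
      e₀ = solve-∀
      e₁ : ∀ s₀ s₁ s₂ m b → s₀ * m + (s₁ * 0ℤ + (s₂ * 0ℤ + 0ℤ)) ≡
           s₀ * m + ((s₁ - + 2 * b * (s₂ - s₁)) * 0ℤ + ((s₂ - s₁) * 0ℤ + 0ℤ))
      e₁ = solve-∀
      e₂ : ∀ s₀ s₁ s₂ m b → s₀ * 0ℤ + (s₁ * m + (s₂ * 0ℤ + 0ℤ)) ≡
           s₀ * 0ℤ + ((s₁ - + 2 * b * (s₂ - s₁)) * m + ((s₂ - s₁) * 0ℤ + 0ℤ))
             + b * (s₂ - s₁) * (m * + 2)
      e₂ = solve-∀
      e₃ : ∀ s₀ s₁ s₂ b → s₀ * 0ℤ + (s₁ * 0ℤ + (s₂ * + 1 + 0ℤ)) ≡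
           s₀ * 0ℤ + ((s₁ - + 2 * b * (s₂ - s₁)) * + 1 +
             ((s₂ - s₁) * (1ℤ + b * + 2) + 0ℤ))
      e₃ = solve-∀
      e₄ : ∀ s₀ s₁ s₂ b → s₀ * 0ℤ + (s₁ * 0ℤ + (s₂ * - + 1 + 0ℤ)) ≡
           s₀ * 0ℤ + ((s₁ - + 2 * b * (s₂ - s₁)) * - + 1 +
             ((s₂ - s₁) * - (1ℤ + b * + 2) + 0ℤ))
      e₄ = solve-∀

    C₀-Lattice : Vector ℤ 5 → Set
    C₀-Lattice x = ∃[ u ] ∃[ v ] ∃[ w ] ∃[ h ]
      x 1F ≡ m * u × x 2F ≡ m * v × x 0F + x 1F + x 2F ≡ + N * w × x 3F + x 4F ≡ + N * h

    C₀⇒lattice : ∀ {x} → x ∈ ⟦ C₀ ⟧ → C₀-Lattice x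
    C₀⇒lattice {x} (s , e) with e 0F | e 1F | e 2F | e 3F | e 4F
    ... | divides q₀ f₀ | divides q₁ f₁ | divides q₂ f₂ | divides q₃ f₃ | divides q₄ f₄ =
      s 0F + q₁ * + 2 , s 1F + q₂ * + 2 , q₀ + q₁ + q₂ + s 0F + s 1F , q₃ + q₄ ,
      trans x₁ (e₁ (s 0F) (s 1F) (s 2F) m q₁) ,
      trans x₂ (e₂ (s 0F) (s 1F) (s 2F) m q₂) ,
      trans (cong₂ _+_ (cong₂ _+_ x₀ x₁) x₂)
        (trans (e₃ (s 0F) (s 1F) (s 2F) m q₀ q₁ q₂) (cong (_* _) (sym n≡m*2))) ,
      trans (cong₂ _+_ (unsub {x 3F} f₃) (unsub {x 4F} f₄))
        (e₄ (s 0F) (s 1F) (s 2F) (+ N) q₃ q₄)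
      where
      unsub : ∀ {x y z} → x - y ≡ z → x ≡ z + y
      unsub {x} {y} e = trans (split x y) (cong (_+ y) e)
        where
        split : ∀ x y → x ≡ (x - y) + y
        split = solve-∀
      unsub₂ : ∀ q {x y} → x - y ≡ q * + N → x ≡ q * (m * + 2) + y
      unsub₂ q e = unsub (trans e (cong (q *_) n≡m*2))
      x₀ = unsub₂ q₀ {x 0F} f₀
      x₁ = unsub₂ q₁ {x 1F} f₁
      x₂ = unsub₂ q₂ {x 2F} f₂
      e₁ : ∀ s₀ s₁ s₂ m q → q * (m * + 2) + (s₀ * m + (s₁ * 0ℤ + (s₂ * 0ℤ + 0ℤ))) ≡
           m * (s₀ + q * + 2)
      e₁ = solve-∀
      e₂ : ∀ s₀ s₁ s₂ m q → q * (m * + 2) + (s₀ * 0ℤ + (s₁ * m + (s₂ * 0ℤ + 0ℤ))) ≡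
           m * (s₁ + q * + 2)
      e₂ = solve-∀
      e₃ : ∀ s₀ s₁ s₂ m q₀ q₁ q₂ →
           q₀ * (m * + 2) + (s₀ * m + (s₁ * m + (s₂ * 0ℤ + 0ℤ))) +
           (q₁ * (m * + 2) + (s₀ * m + (s₁ * 0ℤ + (s₂ * 0ℤ + 0ℤ)))) +
           (q₂ * (m * + 2) + (s₀ * 0ℤ + (s₁ * m + (s₂ * 0ℤ + 0ℤ)))) ≡
           m * + 2 * (q₀ + q₁ + q₂ + s₀ + s₁)
      e₃ = solve-∀
      e₄ : ∀ s₀ s₁ s₂ n q r →
           (q * n + (s₀ * 0ℤ + (s₁ * 0ℤ + (s₂ * + 1 + 0ℤ)))) +
           (r * n + (s₀ * 0ℤ + (s₁ * 0ℤ + (s₂ * - + 1 + 0ℤ)))) ≡ n * (q + r)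
      e₄ = solve-∀

    lattice⇒C₀ : ∀ {x} → C₀-Lattice x → x ∈ ⟦ C₀ ⟧
    lattice⇒C₀ {x} (u , v , w , h , f₁ , f₂ , f₀ , f₃) =
      u ∷ v ∷ x 3F ∷ [] , λ where
        0F → divides (w - u - v) (trans (e₀ (x 0F) (x 1F) (x 2F) u v (x 3F) m)
               (trans (cong₂ (λ y z → y - z + _) (trans f₀ (cong (_* w) n≡m*2))
                        (cong₂ _+_ f₁ f₂))
                 (trans (e₀′ u v w m) (cong ((w - u - v) *_) (sym n≡m*2)))))
        1F → divides 0ℤ (trans (cong (_- (u * m + (v * 0ℤ + (x 3F * 0ℤ + 0ℤ)))) f₁)
               (e₁ u v (x 3F) m))
        2F → divides 0ℤ (trans (cong (_- (u * 0ℤ + (v * m + (x 3F * 0ℤ + 0ℤ)))) f₂)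
               (e₂ u v (x 3F) m))
        3F → divides 0ℤ (e₃ u v (x 3F))
        4F → divides h (trans (e₄ u v (x 3F) (x 4F)) (trans f₃ (ℤₚ.*-comm (+ N) h)))
      where
      e₀ : ∀ x₀ x₁ x₂ u v s m → x₀ - (u * m + (v * m + (s * 0ℤ + 0ℤ))) ≡
           (x₀ + x₁ + x₂) - (x₁ + x₂) + (- (u * m) + - (v * m))
      e₀ = solve-∀
      e₀′ : ∀ u v w m → (m * + 2 * w) - (m * u + m * v) + (- (u * m) + - (v * m)) ≡
            (w - u - v) * (m * + 2)
      e₀′ = solve-∀
      e₁ : ∀ u v s m → m * u - (u * m + (v * 0ℤ + (s * 0ℤ + 0ℤ))) ≡ 0ℤ
      e₁ = solve-∀
      e₂ : ∀ u v s m → m * v - (u * 0ℤ + (v * m + (s * 0ℤ + 0ℤ))) ≡ 0ℤ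
      e₂ = solve-∀
      e₃ : ∀ u v s → s - (u * 0ℤ + (v * 0ℤ + (s * + 1 + 0ℤ))) ≡ 0ℤ
      e₃ = solve-∀
      e₄ : ∀ u v s t → t - (u * 0ℤ + (v * 0ℤ + (s * - + 1 + 0ℤ))) ≡ s + t
      e₄ = solve-∀

    C₀-zeroSum : ZeroSum C₀
    C₀-zeroSum x x∈C₀ =
      let u , v , w , h , _ , _ , f₀ , f₃ = C₀⇒lattice {x} x∈C₀
      in divides (w + h) (trans (regroup (x 0F) (x 1F) (x 2F) (x 3F) (x 4F))
           (trans (cong₂ _+_ f₀ f₃) (e (+ N) w h)))
      where
      regroup : ∀ x₀ x₁ x₂ x₃ x₄ → x₀ + (x₁ + (x₂ + (x₃ + (x₄ + 0ℤ)))) - 0ℤ ≡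
                (x₀ + x₁ + x₂) + (x₃ + x₄)
      regroup = solve-∀
      e : ∀ n w h → n * w + n * h ≡ (w + h) * n
      e = solve-∀

    -- lcm(2, N), lcm(2, N)/2 and lcm(2, N)/N are replaced by variables, so that
    -- their values can be substituted.
    C₀⊆⊕ : ∀ {L q₁ q₂} → N ≡ L → q₁ ≡ m → q₂ ≡ 1ℤ →
      ∀ {x} → x ∈ ⟦ C₀ ⟧ → ∃[ c₁ ] ∃[ c₂ ]
        c₁ ∈ ⟦ span (ℤ/ 2) block₁ ⟧ × c₂ ∈ ⟦ span (ℤ/ N) block₂ ⟧ ×
        (∀ i → _≡ₘ_ L (x i) ((map (q₁ *_) c₁ ++ map (q₂ *_) c₂) i))
    C₀⊆⊕ refl refl refl {x} (s , e) = c₁ , c₂ ,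
      ((s 0F ∷ s 1F ∷ []) , λ i → CommutativeRing.refl (ℤ/ 2) {c₁ i}) ,
      ((s 2F ∷ []) , λ i → CommutativeRing.refl (ℤ/ N) {c₂ i}) , λ where
        0F → ≈-exactly {x = x 0F} (e 0F) (e₀ (s 0F) (s 1F) (s 2F) m)
        1F → ≈-exactly {x = x 1F} (e 1F) (e₁ (s 0F) (s 1F) (s 2F) m)
        2F → ≈-exactly {x = x 2F} (e 2F) (e₂ (s 0F) (s 1F) (s 2F) m)
        3F → ≈-exactly {x = x 3F} (e 3F) (e₃ (s 0F) (s 1F) (s 2F))
        4F → ≈-exactly {x = x 4F} (e 4F) (e₄ (s 0F) (s 1F) (s 2F))
      where
      c₁ : Vector ℤ 3
      c₁ j = s 0F * block₁ 0F j + (s 1F * block₁ 1F j + 0ℤ)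
      c₂ : Vector ℤ 2
      c₂ j = s 2F * block₂ 0F j + 0ℤ
      e₀ : ∀ s₀ s₁ s₂ m → s₀ * m + (s₁ * m + (s₂ * 0ℤ + 0ℤ)) ≡
           m * (s₀ * + 1 + (s₁ * + 1 + 0ℤ))
      e₀ = solve-∀
      e₁ : ∀ s₀ s₁ s₂ m → s₀ * m + (s₁ * 0ℤ + (s₂ * 0ℤ + 0ℤ)) ≡
           m * (s₀ * + 1 + (s₁ * 0ℤ + 0ℤ))
      e₁ = solve-∀
      e₂ : ∀ s₀ s₁ s₂ m → s₀ * 0ℤ + (s₁ * m + (s₂ * 0ℤ + 0ℤ)) ≡
           m * (s₀ * 0ℤ + (s₁ * + 1 + 0ℤ))
      e₂ = solve-∀
      e₃ : ∀ s₀ s₁ s₂ → s₀ * 0ℤ + (s₁ * 0ℤ + (s₂ * + 1 + 0ℤ)) ≡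
           + 1 * (s₂ * + 1 + 0ℤ)
      e₃ = solve-∀
      e₄ : ∀ s₀ s₁ s₂ → s₀ * 0ℤ + (s₁ * 0ℤ + (s₂ * - + 1 + 0ℤ)) ≡
           + 1 * (s₂ * - + 1 + 0ℤ)
      e₄ = solve-∀

    ⊕⊆C₀ : ∀ {L q₁ q₂} → N ≡ L → q₁ ≡ m → q₂ ≡ 1ℤ →
      ∀ {x c₁ c₂} → c₁ ∈ ⟦ span (ℤ/ 2) block₁ ⟧ → c₂ ∈ ⟦ span (ℤ/ N) block₂ ⟧ →
      (∀ i → _≡ₘ_ L (x i) ((map (q₁ *_) c₁ ++ map (q₂ *_) c₂) i)) → x ∈ ⟦ C₀ ⟧
    ⊕⊆C₀ refl refl refl {x} {c₁} {c₂} (s , e) (t , f) x≈ =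
      (s 0F ∷ s 1F ∷ t 0F ∷ []) , λ where
        0F → first 0F (e₀ (s 0F) (s 1F) (t 0F) m)
        1F → first 1F (e₁ (s 0F) (s 1F) (t 0F) m)
        2F → first 2F (e₂ (s 0F) (s 1F) (t 0F) m)
        3F → second 0F (e₃ (s 0F) (s 1F) (t 0F))
        4F → second 1F (e₄ (s 0F) (s 1F) (t 0F))
      where
      scale : ∀ {y z} → _≡ₘ_ 2 y z → _≡ₘ_ N (m * y) (m * z)
      scale {y} {z} (divides q e) = divides q (trans (factor m y z)
        (trans (cong (m *_) e) (trans (rotate m q) (cong (q *_) (sym n≡m*2)))))
        where
        factor : ∀ m y z → m * y - m * z ≡ m * (y - z)
        factor = solve-∀
        rotate : ∀ m q → m * (q * + 2) ≡ q * (m * + 2)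
        rotate = solve-∀
      first : ∀ i {z} → m * (s 0F * block₁ 0F i + (s 1F * block₁ 1F i + 0ℤ)) ≡ z →
              _≡ₘ_ N (x (i ↑ˡ 2)) z
      first i p = ≈-exactly {x = x (i ↑ˡ 2)} (CommutativeRing.trans (ℤ/ N)
        {x (i ↑ˡ 2)} {m * c₁ i} (x≈′ i) (scale {c₁ i} (e i))) p
        where
        x≈′ : ∀ i → _≡ₘ_ N (x (i ↑ˡ 2)) (m * c₁ i)
        x≈′ 0F = x≈ 0F
        x≈′ 1F = x≈ 1F
        x≈′ 2F = x≈ 2F
      second : ∀ i {z} → t 0F * block₂ 0F i + 0ℤ ≡ z → _≡ₘ_ N (x (3 ↑ʳ i)) z
      second i p = ≈-exactly {x = x (3 ↑ʳ i)} (CommutativeRing.trans (ℤ/ N)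
        {x (3 ↑ʳ i)} {c₂ i} (x≈′ i) (f i)) p
        where
        x≈′ : ∀ i → _≡ₘ_ N (x (3 ↑ʳ i)) (c₂ i)
        x≈′ 0F = ≈-exactly {x = x 3F} (x≈ 3F) (ℤₚ.*-identityˡ _)
        x≈′ 1F = ≈-exactly {x = x 4F} (x≈ 4F) (ℤₚ.*-identityˡ _)
      e₀ : ∀ s₀ s₁ t m → m * (s₀ * + 1 + (s₁ * + 1 + 0ℤ)) ≡
           s₀ * m + (s₁ * m + (t * 0ℤ + 0ℤ))
      e₀ = solve-∀
      e₁ : ∀ s₀ s₁ t m → m * (s₀ * + 1 + (s₁ * 0ℤ + 0ℤ)) ≡
           s₀ * m + (s₁ * 0ℤ + (t * 0ℤ + 0ℤ))
      e₁ = solve-∀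
      e₂ : ∀ s₀ s₁ t m → m * (s₀ * 0ℤ + (s₁ * + 1 + 0ℤ)) ≡
           s₀ * 0ℤ + (s₁ * m + (t * 0ℤ + 0ℤ))
      e₂ = solve-∀
      e₃ : ∀ s₀ s₁ t → t * + 1 + 0ℤ ≡ s₀ * 0ℤ + (s₁ * 0ℤ + (t * + 1 + 0ℤ))
      e₃ = solve-∀
      e₄ : ∀ s₀ s₁ t → t * - + 1 + 0ℤ ≡ s₀ * 0ℤ + (s₁ * 0ℤ + (t * - + 1 + 0ℤ))
      e₄ = solve-∀

    -- The inverse of the coordinates (2x₁/N, 2x₂/N, x₄, (x₃ + x₄)/N) on the
    -- hyperplane Σ xᵢ = N.
    joinMatrix : Vector (Vector ℤ 4) 5
    joinMatrix = (- m ∷ - m ∷ 0ℤ  ∷ - + N ∷ [])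
               ∷ (m   ∷ 0ℤ  ∷ 0ℤ  ∷ 0ℤ    ∷ [])
               ∷ (0ℤ  ∷ m   ∷ 0ℤ  ∷ 0ℤ    ∷ [])
               ∷ (0ℤ  ∷ 0ℤ  ∷ -1ℤ ∷ + N   ∷ [])
               ∷ (0ℤ  ∷ 0ℤ  ∷ 1ℤ  ∷ 0ℤ    ∷ [])
               ∷ []

    joinTranslation : Vector ℤ 5
    joinTranslation = + N ∷ 0ℤ ∷ 0ℤ ∷ 0ℤ ∷ 0ℤ ∷ []

    joinWord : Vector ℤ 4 → Vector ℤ 5
    joinWord y i = sumℤ (λ j → joinMatrix i j * y j) + joinTranslation i

    joinWord-lattice : ∀ y → C₀-Lattice (joinWord y)
    joinWord-lattice y = y 0F , y 1F , 1ℤ - y 3F , y 3F ,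
      e₁ m (y 0F) (y 1F) (y 2F) (y 3F) ,
      e₂ m (y 0F) (y 1F) (y 2F) (y 3F) ,
      e₃ m (+ N) (y 0F) (y 1F) (y 2F) (y 3F) ,
      e₄ (+ N) (y 0F) (y 1F) (y 2F) (y 3F)
      where
      e₁ : ∀ m u v w h → m * u + (0ℤ * v + (0ℤ * w + (0ℤ * h + 0ℤ))) + 0ℤ ≡ m * u
      e₁ = solve-∀
      e₂ : ∀ m u v w h → 0ℤ * u + (m * v + (0ℤ * w + (0ℤ * h + 0ℤ))) + 0ℤ ≡ m * v
      e₂ = solve-∀
      e₃ : ∀ m n u v w h →
           (- m * u + (- m * v + (0ℤ * w + (- n * h + 0ℤ))) + n) +
           (m * u + (0ℤ * v + (0ℤ * w + (0ℤ * h + 0ℤ))) + 0ℤ) +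
           (0ℤ * u + (m * v + (0ℤ * w + (0ℤ * h + 0ℤ))) + 0ℤ) ≡
           n * (1ℤ - h)
      e₃ = solve-∀
      e₄ : ∀ n u v w h →
           (0ℤ * u + (0ℤ * v + (- (+ 1) * w + (n * h + 0ℤ))) + 0ℤ) +
           (0ℤ * u + (0ℤ * v + (+ 1 * w + (0ℤ * h + 0ℤ))) + 0ℤ) ≡ n * h
      e₄ = solve-∀

    module _ .{{_ : NonZero N}} where

      lcm[2,N]≡N : lcm 2 N ≡ N
      lcm[2,N]≡N = ℕ∣.∣-antisym (lcm-least (ℕ∣.divides M N≡M*2) ℕ∣.∣-refl) (n∣lcm[m,n] 2 N)

      lcm[2,N]/2≡M : + ℕ∣.quotient (m∣lcm[m,n] 2 N) ≡ m
      lcm[2,N]/2≡M = cong +_ (ℕₚ.*-cancelʳ-≡ _ M 2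
        (trans (sym (ℕ∣._∣_.equality (m∣lcm[m,n] 2 N))) (trans lcm[2,N]≡N N≡M*2)))

      lcm[2,N]/N≡1 : + ℕ∣.quotient (n∣lcm[m,n] 2 N) ≡ 1ℤ
      lcm[2,N]/N≡1 = cong +_ (ℕₚ.*-cancelʳ-≡ _ 1 N
        (trans (sym (ℕ∣._∣_.equality (n∣lcm[m,n] 2 N)))
          (trans lcm[2,N]≡N (sym (ℕₚ.*-identityˡ N)))))

      C₀≐⊕ : ⟦ C₀ ⟧ ≐ ⟦ subst (λ L → Code L 5) lcm[2,N]≡N
                        (span (ℤ/ 2) block₁ ⊕ span (ℤ/ N) block₂) ⟧
      C₀≐⊕ = (λ {x} x∈C₀ → subst (x ∈_) (sym words)
                  (C₀⊆⊕ (sym lcm[2,N]≡N) lcm[2,N]/2≡M lcm[2,N]/N≡1 {x} x∈C₀))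
           , (λ {x} x∈⊕ → let (c₁ , c₂ , c₁∈ , c₂∈ , e) = subst (x ∈_) words x∈⊕ in
                  ⊕⊆C₀ (sym lcm[2,N]≡N) lcm[2,N]/2≡M lcm[2,N]/N≡1 {x} {c₁} {c₂} c₁∈ c₂∈ e)
        where
        words = subst-words lcm[2,N]≡N (span (ℤ/ 2) block₁ ⊕ span (ℤ/ N) block₂)

module OrderedFieldProperties {c ℓ₁ ℓ₂ ℓ₃} (K : OrderedField c ℓ₁ ℓ₂ ℓ₃) where

  open OrderedField K using
    (_#_; _<_; _≤_; commutativeRing; heytingCommutativeRing; isStrictPartialOrder;
     #-sym; #-cotrans; #⇒invertible; <⇒#; #⇒<⊎>; +-monoˡ-<; *-pos)
  open CommutativeRing commutativeRing hiding (zero)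
  open Geometry K
  open AbelianGroupProperties +-abelianGroup
    renaming (ε⁻¹≈ε to -0≈0; ⁻¹-involutive to -‿involutive; ⁻¹-∙-comm to -‿+-comm)
    using ()
  open RingProperties ring using (-‿distribˡ-*)
  open SemiringMult semiring using (×-homo-+; ×-homo-1) renaming (_×_ to _·_)
  open SemiringSum semiring

  open import Relation.Binary.Reasoning.Setoid setoid
  module < = IsStrictPartialOrder isStrictPartialOrder

  private
    almostCommutativeRing : AlmostCommutativeRing c ℓ₁
    almostCommutativeRing = fromCommutativeRing commutativeRing

  ι-neg : ∀ z → ι (ℤ.- z) ≈ - ι z
  ι-neg (+ zero)   = sym -0≈0
  ι-neg (+ suc n)  = refl
  ι-neg (-[1+ n ]) = sym (-‿involutive _)

  ι-⊖ : ∀ m n → ι (m ℤ.⊖ n) ≈ ι (+ m) - ι (+ n)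
  ι-⊖ zero    zero    = sym (-‿inverseʳ 0#)
  ι-⊖ zero    (suc n) = sym (+-identityˡ _)
  ι-⊖ (suc m) zero    = sym (trans (+-congˡ -0≈0) (+-identityʳ _))
  ι-⊖ (suc m) (suc n) = begin
    ι (suc m ℤ.⊖ suc n)                 ≡⟨ ≡.cong ι (ℤₚ.[1+m]⊖[1+n]≡m⊖n m n) ⟩
    ι (m ℤ.⊖ n)                         ≈⟨ ι-⊖ m n ⟩
    ι (+ m) - ι (+ n)                   ≈⟨ +-congʳ (+-identityʳ _) ⟨
    ι (+ m) + 0# - ι (+ n)              ≈⟨ +-congʳ (+-congˡ (-‿inverseʳ 1#)) ⟨
    ι (+ m) + (1# - 1#) - ι (+ n)       ≈⟨ +-congʳ (+-assoc _ _ _) ⟨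
    ι (+ m) + 1# - 1# - ι (+ n)         ≈⟨ +-assoc _ _ _ ⟩
    ι (+ m) + 1# + (- 1# - ι (+ n))     ≈⟨ +-cong (+-comm _ _) (-‿+-comm _ _) ⟩
    ι (+ suc m) - ι (+ suc n)           ∎

  ι-+ : ∀ y z → ι (y ℤ.+ z) ≈ ι y + ι z
  ι-+ (+ m)    (+ n)    = ×-homo-+ 1# m n
  ι-+ (+ m)    -[1+ n ] = ι-⊖ m (suc n)
  ι-+ -[1+ m ] (+ n)    = trans (ι-⊖ n (suc m)) (+-comm _ _)
  ι-+ -[1+ m ] -[1+ n ] = begin
    - ι (+ suc (suc (m ℕ.+ n)))     ≡⟨ ≡.cong (λ k → - ι (+ suc k)) (ℕₚ.+-suc m n) ⟨
    - ι (+ (suc m ℕ.+ suc n))       ≈⟨ -‿cong (×-homo-+ 1# (suc m) (suc n)) ⟩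
    - (ι (+ suc m) + ι (+ suc n))   ≈⟨ -‿+-comm _ _ ⟨
    - ι (+ suc m) - ι (+ suc n)     ∎

  ι-1 : ι 1ℤ ≈ 1#
  ι-1 = ×-homo-1 1#

  ι-* : ∀ y z → ι (y ℤ.* z) ≈ ι y * ι z
  ι-* (+ m) z = go m
    where
    go : ∀ m → ι (+ m ℤ.* z) ≈ ι (+ m) * ι z
    go zero    = sym (zeroˡ _)
    go (suc m) = begin
      ι (+ suc m ℤ.* z)         ≡⟨ ≡.cong ι (ℤₚ.suc-* (+ m) z) ⟩
      ι (z ℤ.+ + m ℤ.* z)       ≈⟨ ι-+ z (+ m ℤ.* z) ⟩
      ι z + ι (+ m ℤ.* z)       ≈⟨ +-cong (sym (*-identityˡ _)) (go m) ⟩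
      1# * ι z + ι (+ m) * ι z  ≈⟨ distribʳ _ _ _ ⟨
      ι (+ suc m) * ι z         ∎
  ι-* y@(-[1+ m ]) z = begin
    ι (y ℤ.* z)               ≡⟨ ≡.cong ι (ℤₚ.neg-distribˡ-* (+ suc m) z) ⟨
    ι (ℤ.- (+ suc m ℤ.* z))   ≈⟨ ι-neg (+ suc m ℤ.* z) ⟩
    - ι (+ suc m ℤ.* z)       ≈⟨ -‿cong (ι-* (+ suc m) z) ⟩
    - (ι (+ suc m) * ι z)     ≈⟨ -‿distribˡ-* _ _ ⟩
    ι y * ι z                 ∎

  ι-sum : ∀ {n} (z : Vector ℤ n) → ι (sumℤ z) ≈ sum (map ι z)
  ι-sum {zero}  z = refl
  ι-sum {suc n} z = trans (ι-+ (z zero) _) (+-congˡ (ι-sum (z ∘ suc)))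

  ℤ⟶K : ℤ.+-*-rawRing -Raw-AlmostCommutative⟶ almostCommutativeRing
  ℤ⟶K = record
    { ⟦_⟧ = ι ; +-homo = ι-+ ; *-homo = ι-* ; -‿homo = ι-neg
    ; 0-homo = refl ; 1-homo = ι-1 }

  open RingSolver ℤ.+-*-rawRing almostCommutativeRing ℤ⟶K
    (λ y z → mapMaybe (λ y≡z → reflexive (≡.cong ι y≡z)) (dec⇒maybe (y ℤₚ.≟ z))) public
    using (solve; _:+_; _:*_; :-_; _:-_; _:=_; con)

  ≤-resp-≈ : ∀ {x y x′ y′} → x ≈ x′ → y ≈ y′ → x ≤ y → x′ ≤ y′
  ≤-resp-≈ x≈x′ y≈y′ x≤y y′<x′ =
    x≤y (<.<-respˡ-≈ (sym y≈y′) (<.<-respʳ-≈ (sym x≈x′) y′<x′))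

  ≤-refl : ∀ {x} → x ≤ x
  ≤-refl = <.irrefl refl

  <⇒≤ : ∀ {x y} → x < y → x ≤ y
  <⇒≤ = <.asym

  x<0⇒0<-x : ∀ {x} → x < 0# → 0# < - x
  x<0⇒0<-x {x} x<0 =
    <.<-respˡ-≈ (-‿inverseʳ x) (<.<-respʳ-≈ (+-identityˡ _) (+-monoˡ-< (- x) x<0))

  0≤x∧x#0⇒0<x : ∀ {x} → 0# ≤ x → x # 0# → 0# < x
  0≤x∧x#0⇒0<x 0≤x x#0 with #⇒<⊎> x#0
  ... | inj₁ x<0 = contradiction x<0 0≤x
  ... | inj₂ 0<x = 0<x

  0<x⇒y<x+y : ∀ {x} y → 0# < x → y < x + y
  0<x⇒y<x+y y 0<x = <.<-respˡ-≈ (+-identityˡ y) (+-monoˡ-< y 0<x)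

  0<1 : 0# < 1#
  0<1 with #⇒<⊎> (1#0 heytingCommutativeRing)
  ... | inj₂ 0<1 = 0<1
  ... | inj₁ 1<0 = <.<-respʳ-≈
    (trans (solve 1 (λ o → :- o :* :- o := o :* o) refl 1#) (*-identityˡ 1#))
    (*-pos (x<0⇒0<-x 1<0) (x<0⇒0<-x 1<0))

  -- As _≤_ is a negation, nonnegativity is proved by refuting negativity, and
  -- cotransitivity of _#_ then makes the signs of the terms comparable.
  +-nonneg : ∀ {x y} → 0# ≤ x → 0# ≤ y → 0# ≤ x + y
  +-nonneg {x} {y} 0≤x 0≤y x+y<0 with #-cotrans (<⇒# x+y<0) y
  ... | inj₂ y#0 =
    0≤x (<.trans (<.<-respʳ-≈ (+-comm y x) (0<x⇒y<x+y x (0≤x∧x#0⇒0<x 0≤y y#0))) x+y<0)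
  ... | inj₁ x+y#y with #⇒<⊎> x+y#y
  ...   | inj₂ y<x+y = 0≤y (<.trans y<x+y x+y<0)
  ...   | inj₁ x+y<y = 0≤x (<.<-respʳ-≈ (-‿inverseʳ y)
    (<.<-respˡ-≈ (solve 2 (λ x y → x :+ y :- y := x) refl x y) (+-monoˡ-< (- y) x+y<y)))

  xy#0⇒x#0 : ∀ {x y} → x * y # 0# → x # 0#
  xy#0⇒x#0 {x} {y} xy#0 with #⇒invertible xy#0
  ... | w , w[xy]≈1 , _ = invertibleˡ⇒# heytingCommutativeRing (w * y , trans
    (solve 3 (λ w x y → w :* y :* (x :- con 0ℤ) := w :* (x :* y :- con 0ℤ)) refl w x y)
    w[xy]≈1)

  *-nonneg : ∀ {x y} → 0# ≤ x → 0# ≤ y → 0# ≤ x * y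
  *-nonneg {x} {y} 0≤x 0≤y xy<0 =
    <.asym xy<0 (*-pos (0≤x∧x#0⇒0<x 0≤x (xy#0⇒x#0 xy#0))
                       (0≤x∧x#0⇒0<x 0≤y (xy#0⇒x#0 yx#0)))
    where
    xy#0 : x * y # 0#
    xy#0 = <⇒# xy<0
    yx#0 : y * x # 0#
    yx#0 = #-congʳ heytingCommutativeRing (*-comm x y) xy#0

  sum-nonneg : ∀ {n} {t : Vector Carrier n} → (∀ i → 0# ≤ t i) → 0# ≤ sum t
  sum-nonneg {zero}  _   = ≤-refl
  sum-nonneg {suc n} 0≤t = +-nonneg (0≤t zero) (sum-nonneg (0≤t ∘ suc))

  ι-nonneg : ∀ n → 0# ≤ ι (+ n)
  ι-nonneg zero    = ≤-refl
  ι-nonneg (suc n) = +-nonneg (<⇒≤ 0<1) (ι-nonneg n)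

  ι-pos : ∀ n .{{_ : NonZero n}} → 0# < ι (+ n)
  ι-pos (suc zero)    = <.<-respʳ-≈ (sym ι-1) 0<1
  ι-pos (suc (suc n)) = <.trans (ι-pos (suc n)) (0<x⇒y<x+y _ 0<1)

  inverse-nonneg : ∀ {x y} → 0# < x → x * y ≈ 1# → 0# ≤ y
  inverse-nonneg {x} {y} 0<x xy≈1 y<0 = <.asym 0<1 (<.<-respʳ-≈ (-‿inverseˡ 1#)
    (0<x⇒y<x+y 1# (<.<-respʳ-≈
      (trans (solve 2 (λ x y → x :* :- y := :- (x :* y)) refl x y) (-‿cong xy≈1))
      (*-pos 0<x (x<0⇒0<-x y<0)))))

  ι-inverse : ∀ n .{{_ : NonZero n}} → ∃[ y ] ι (+ n) * y ≈ 1#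
  ι-inverse n with #⇒invertible (#-sym (<⇒# (ι-pos n)))
  ... | y , _ , [n-0]y≈1 =
    y , trans (*-congʳ (sym (x-0≈x heytingCommutativeRing _))) [n-0]y≈1

module AffineGeometry {c ℓ₁ ℓ₂ ℓ₃} (K : OrderedField c ℓ₁ ℓ₂ ℓ₃) where

  open OrderedField K using (_≤_; commutativeRing)
  open CommutativeRing commutativeRing hiding (zero)
  open Geometry K
  open OrderedFieldProperties K
  open SemiringSum semiring
  open import Relation.Binary.Reasoning.Setoid setoid

  private
    variable
      d : ℕ
      φ ψ : Point d → Carrier

  apply-cong : ∀ {d e} (A : AffineMap d e) {x y} → x ≋ y →
               AffineMap.apply A x ≋ AffineMap.apply A y
  apply-cong A x≋y i = +-congʳ (sum-cong-≋ λ j → *-congˡ (x≋y j))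

  Affine : (Point d → Carrier) → Set (c ⊔ ℓ₁)
  Affine {d} φ = ∀ {k} (t : Vector Carrier k) (p : Vector (Point d) k) {x} →
    sum t ≈ 1# → x ≋ combination t p → φ x ≈ sum (λ i → t i * φ (p i))

  affine-coordinate : ∀ j → Affine {d} (λ x → x j)
  affine-coordinate j t p Σt≈1 x≋ = x≋ j

  affine-const : ∀ b → Affine {d} (λ _ → b)
  affine-const b t p Σt≈1 x≋ = begin
    b                        ≈⟨ *-identityˡ b ⟨
    1# * b                   ≈⟨ *-congʳ Σt≈1 ⟨
    sum t * b                ≈⟨ *-distribʳ-sum b t ⟩
    sum (λ i → t i * b)      ∎

  affine-+ : Affine φ → Affine ψ → Affine (λ x → φ x + ψ x)
  affine-+ {φ = φ} {ψ = ψ} aφ aψ t p {x} Σt≈1 x≋ = begin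
    φ x + ψ x
      ≈⟨ +-cong (aφ t p Σt≈1 x≋) (aψ t p Σt≈1 x≋) ⟩
    sum (λ i → t i * φ (p i)) + sum (λ i → t i * ψ (p i))
      ≈⟨ ∑-distrib-+ (λ i → t i * φ (p i)) (λ i → t i * ψ (p i)) ⟨
    sum (λ i → t i * φ (p i) + t i * ψ (p i))
      ≈⟨ sum-cong-≋ (λ i → distribˡ (t i) _ _) ⟨
    sum (λ i → t i * (φ (p i) + ψ (p i)))
      ∎

  affine-* : ∀ a → Affine φ → Affine (λ x → a * φ x)
  affine-* {φ = φ} a aφ t p {x} Σt≈1 x≋ = begin
    a * φ x                            ≈⟨ *-congˡ (aφ t p Σt≈1 x≋) ⟩
    a * sum (λ i → t i * φ (p i))      ≈⟨ *-distribˡ-sum a (λ i → t i * φ (p i)) ⟩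
    sum (λ i → a * (t i * φ (p i)))    ≈⟨ sum-cong-≋ (λ i →
      solve 3 (λ a t y → a :* (t :* y) := t :* (a :* y)) refl a (t i) (φ (p i))) ⟩
    sum (λ i → t i * (a * φ (p i)))    ∎

  affine-sum : ∀ {n} {φ : Fin n → Point d → Carrier} →
               (∀ j → Affine (φ j)) → Affine (λ x → sum (λ j → φ j x))
  affine-sum {n = zero}  aφ = affine-const 0#
  affine-sum {n = suc n} aφ = affine-+ (aφ zero) (affine-sum (aφ ∘ suc))

  affine-apply : ∀ {n} (A : AffineMap d n) i → Affine (λ x → AffineMap.apply A x i)
  affine-apply A i =
    affine-+ (affine-sum (λ j → affine-* (AffineMap.matrix A i j) (affine-coordinate j)))
             (affine-const (AffineMap.translation A i))

  affine-nonneg : Affine φ → ∀ {k t p x} → (∀ (i : Fin k) → 0# ≤ t i) → sum t ≈ 1# →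
                  x ≋ combination t p → (∀ i → 0# ≤ φ (p i)) → 0# ≤ φ x
  affine-nonneg aφ {t = t} {p} t≥0 Σt≈1 x≋ φp≥0 =
    ≤-resp-≈ refl (sym (aφ t p Σt≈1 x≋)) (sum-nonneg (λ i → *-nonneg (t≥0 i) (φp≥0 i)))

  module _ {ℓ} (S : Pred (Point d) ℓ) where

    ⊆conv : S ⊆ conv S
    ⊆conv {x} x∈S = 1 , (λ _ → x) , (λ _ → 1#) , (λ _ → x∈S) , (λ _ → <⇒≤ 0<1) ,
      +-identityʳ 1# , λ j → sym (trans (+-identityʳ _) (*-identityˡ (x j)))

    conv⊆aff : conv S ⊆ aff S
    conv⊆aff (k , p , t , p∈S , _ , Σt≈1 , x≋) = k , p , t , p∈S , Σt≈1 , x≋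

    affine-conv-nonneg : Affine φ → (∀ {p} → p ∈ S → 0# ≤ φ p) →
                         ∀ {x} → x ∈ conv S → 0# ≤ φ x
    affine-conv-nonneg aφ φ≥0 (_ , _ , _ , p∈S , t≥0 , Σt≈1 , x≋) =
      affine-nonneg aφ t≥0 Σt≈1 x≋ (φ≥0 ∘ p∈S)

    affine-aff-const : ∀ {b} → Affine φ → (∀ {p} → p ∈ S → φ p ≈ b) →
                       ∀ {x} → x ∈ aff S → φ x ≈ b
    affine-aff-const {φ = φ} {b} aφ φ≈b {x} (k , p , t , p∈S , Σt≈1 , x≋) = begin
      φ x                          ≈⟨ aφ t p Σt≈1 x≋ ⟩
      sum (λ i → t i * φ (p i))    ≈⟨ sum-cong-≋ (λ i → *-congˡ (φ≈b (p∈S i))) ⟩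
      sum (λ i → t i * b)          ≈⟨ affine-const b t p Σt≈1 x≋ ⟨
      b                            ∎

  sum-scaledBasis : ∀ n N i → sum (scaledBasis n N i) ≈ ι (+ N)
  sum-scaledBasis (suc n) N zero    =
    trans (+-congˡ (sum-replicate-zero n)) (+-identityʳ _)
  sum-scaledBasis (suc n) N (suc i) = trans (+-identityˡ _) (sum-scaledBasis n N i)

  combination-scaledBasis : ∀ {n} (t : Vector Carrier n) N →
    combination t (scaledBasis n N) ≋ (λ j → t j * ι (+ N))
  combination-scaledBasis {suc n} t N zero = trans
    (+-congˡ (trans (sum-cong-≋ (λ i → zeroʳ (t (suc i)))) (sum-replicate-zero n)))
    (+-identityʳ _)
  combination-scaledBasis {suc n} t N (suc j) = trans
    (+-cong (zeroʳ (t zero)) (combination-scaledBasis (t ∘ suc) N j)) (+-identityˡ _)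

  scaledBasis-nonneg : ∀ {n} N i j → 0# ≤ scaledBasis n N i j
  scaledBasis-nonneg N i j with i ≟ j
  ... | yes _ = ι-nonneg N
  ... | no  _ = ≤-refl

  scaledSimplex : ∀ n → ℕ → Pred (Point n) ℓ₁
  scaledSimplex n N = range (scaledBasis n N)

  aff-scaledSimplex-sum : ∀ {n} N {x} → x ∈ aff (scaledSimplex n N) → sum x ≈ ι (+ N)
  aff-scaledSimplex-sum {n} N = affine-aff-const (scaledSimplex n N) (affine-sum affine-coordinate)
    λ (i , p≋) → trans (sum-cong-≋ p≋) (sum-scaledBasis n N i)

  conv-scaledSimplex-nonneg : ∀ {n} N {x} → x ∈ conv (scaledSimplex n N) → ∀ j → 0# ≤ x j
  conv-scaledSimplex-nonneg {n} N x∈ j = affine-conv-nonneg (scaledSimplex n N) (affine-coordinate j)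
    (λ (i , p≋) → ≤-resp-≈ refl (sym (p≋ j)) (scaledBasis-nonneg N i j)) x∈

  module _ {n N k} (Nk≈1 : ι (+ N) * k ≈ 1#) {x : Point n} (Σx≈N : sum x ≈ ι (+ N)) where

    barycentric-sum : sum (map (k *_) x) ≈ 1#
    barycentric-sum = begin
      sum (map (k *_) x)    ≈⟨ *-distribˡ-sum k x ⟨
      k * sum x             ≈⟨ *-congˡ Σx≈N ⟩
      k * ι (+ N)           ≈⟨ *-comm _ _ ⟩
      ι (+ N) * k           ≈⟨ Nk≈1 ⟩
      1#                    ∎

    barycentric-combination : x ≋ combination (map (k *_) x) (scaledBasis n N)
    barycentric-combination j = begin
      x j                    ≈⟨ *-identityˡ (x j) ⟨
      1# * x j               ≈⟨ *-congʳ Nk≈1 ⟨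
      ι (+ N) * k * x j      ≈⟨ solve 3 (λ n k x → n :* k :* x := k :* x :* n) refl (ι (+ N)) k (x j) ⟩
      k * x j * ι (+ N)      ≈⟨ combination-scaledBasis (map (k *_) x) N j ⟨
      combination (map (k *_) x) (scaledBasis n N) j  ∎

    sum⇒aff : x ∈ aff (scaledSimplex n N)
    sum⇒aff = n , scaledBasis n N , map (k *_) x , (λ i → i , λ _ → refl) ,
      barycentric-sum , barycentric-combination

    nonneg⇒conv : 0# ≤ k → (∀ j → 0# ≤ x j) → x ∈ conv (scaledSimplex n N)
    nonneg⇒conv 0≤k x≥0 = n , scaledBasis n N , map (k *_) x , (λ i → i , λ _ → refl) ,
      (λ i → *-nonneg 0≤k (x≥0 i)) , barycentric-sum , barycentric-combination

open Codes

module SimplexIsomorphism {c ℓ₁ ℓ₂ ℓ₃} (K : OrderedField c ℓ₁ ℓ₂ ℓ₃)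
                          (N M : ℕ) .{{_ : NonZero N}} (N≡M*2 : N ≡ M ℕ.* 2) where

  open OrderedField K using (_≤_; commutativeRing)
  open CommutativeRing commutativeRing hiding (zero)
  open Geometry K
  open AffineMap using (apply)
  open OrderedFieldProperties K
  open AffineGeometry K
  open RingProperties ring using (-1*x≈-x)
  open SemiringSum semiring
  open import Relation.Binary.Reasoning.Setoid setoid
  open EvenModulus N M N≡M*2

  private

    m n k two : Carrier
    m = ι (+ M)
    n = ι (+ N)
    k = proj₁ (ι-inverse N)
    two = ι (+ 2)

    nk≈1 : n * k ≈ 1#
    nk≈1 = proj₂ (ι-inverse N)

    0≤k : 0# ≤ k
    0≤k = inverse-nonneg (ι-pos N) nk≈1

    n≈m*2 : n ≈ m * two
    n≈m*2 = trans (reflexive (≡.cong ι n≡m*2)) (ι-* (+ M) (+ 2))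

    nka≈a : ∀ a → n * (k * a) ≈ a
    nka≈a a = trans (sym (*-assoc n k a)) (trans (*-congʳ nk≈1) (*-identityˡ a))

    m2ka≈a : ∀ a → m * (two * k * a) ≈ a
    m2ka≈a a = begin
      m * (two * k * a)   ≈⟨ solve 4 (λ m t k a → m :* (t :* k :* a) := m :* t :* (k :* a)) refl m two k a ⟩
      m * two * (k * a)   ≈⟨ *-congʳ n≈m*2 ⟨
      n * (k * a)         ≈⟨ nka≈a a ⟩
      a                   ∎

    kna≈a : ∀ a → k * (n * a) ≈ a
    kna≈a a = trans (solve 3 (λ k n a → k :* (n :* a) := n :* (k :* a)) refl k n a) (nka≈a a)

    2kma≈a : ∀ a → two * k * (m * a) ≈ a
    2kma≈a a = trans
      (solve 4 (λ m t k a → t :* k :* (m :* a) := m :* (t :* k :* a)) refl m two k a)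
      (m2ka≈a a)

    to : AffineMap 5 4
    to = record
      { matrix = (0# ∷ two * k ∷ 0#      ∷ 0# ∷ 0# ∷ [])
               ∷ (0# ∷ 0#      ∷ two * k ∷ 0# ∷ 0# ∷ [])
               ∷ (0# ∷ 0#      ∷ 0#      ∷ 0# ∷ ι 1ℤ ∷ [])
               ∷ (0# ∷ 0#      ∷ 0#      ∷ k  ∷ k  ∷ [])
               ∷ []
      ; translation = replicate 4 0#
      }

    toCoordinates : Point 5 → Point 4
    toCoordinates x = two * k * x 1F ∷ two * k * x 2F ∷ x 4F ∷ k * (x 3F + x 4F) ∷ []

    to-coordinates : ∀ {x y} → x ≋ y → apply to x ≋ toCoordinates y
    to-coordinates {y = y} x≋y i = trans (apply-cong to x≋y i) (evaluate y i)
      where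
      evaluate : ∀ x → apply to x ≋ toCoordinates x
      evaluate x 0F = solve 6 (λ a x₀ x₁ x₂ x₃ x₄ →
        con 0ℤ :* x₀ :+ (a :* x₁ :+ (con 0ℤ :* x₂ :+ (con 0ℤ :* x₃ :+ (con 0ℤ :* x₄ :+ con 0ℤ))))
          :+ con 0ℤ := a :* x₁) refl (two * k) (x 0F) (x 1F) (x 2F) (x 3F) (x 4F)
      evaluate x 1F = solve 6 (λ a x₀ x₁ x₂ x₃ x₄ →
        con 0ℤ :* x₀ :+ (con 0ℤ :* x₁ :+ (a :* x₂ :+ (con 0ℤ :* x₃ :+ (con 0ℤ :* x₄ :+ con 0ℤ))))
          :+ con 0ℤ := a :* x₂) refl (two * k) (x 0F) (x 1F) (x 2F) (x 3F) (x 4F)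
      evaluate x 2F = solve 5 (λ x₀ x₁ x₂ x₃ x₄ →
        con 0ℤ :* x₀ :+ (con 0ℤ :* x₁ :+ (con 0ℤ :* x₂ :+ (con 0ℤ :* x₃ :+ (con 1ℤ :* x₄ :+ con 0ℤ))))
          :+ con 0ℤ := x₄) refl (x 0F) (x 1F) (x 2F) (x 3F) (x 4F)
      evaluate x 3F = solve 6 (λ a x₀ x₁ x₂ x₃ x₄ →
        con 0ℤ :* x₀ :+ (con 0ℤ :* x₁ :+ (con 0ℤ :* x₂ :+ (a :* x₃ :+ (a :* x₄ :+ con 0ℤ))))
          :+ con 0ℤ := a :* (x₃ :+ x₄)) refl k (x 0F) (x 1F) (x 2F) (x 3F) (x 4F)

    from : AffineMap 4 5
    from = record { matrix = map (map ι) joinMatrix ; translation = map ι joinTranslation }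

    fromCoordinates : Point 4 → Point 5
    fromCoordinates y =
      - m * (y 0F + y 1F) + - n * y 3F + n ∷ m * y 0F ∷ m * y 1F ∷ n * y 3F - y 2F ∷ y 2F ∷ []

    from-coordinates : ∀ {x y} → x ≋ y → apply from x ≋ fromCoordinates y
    from-coordinates {y = y} x≋y i = trans (apply-cong from x≋y i) (evaluate y i)
      where
      evaluate : ∀ y → apply from y ≋ fromCoordinates y
      evaluate y 0F = trans (solve 7 (λ m⁻ n⁻ n u v w h →
        m⁻ :* u :+ (m⁻ :* v :+ (con 0ℤ :* w :+ (n⁻ :* h :+ con 0ℤ))) :+ n :=
        m⁻ :* (u :+ v) :+ n⁻ :* h :+ n) refl
          (ι (ℤ.- + M)) (ι (ℤ.- + N)) n (y 0F) (y 1F) (y 2F) (y 3F))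
        (+-congʳ (+-cong (*-congʳ (ι-neg (+ M))) (*-congʳ (ι-neg (+ N)))))
      evaluate y 1F = solve 5 (λ m u v w h →
        m :* u :+ (con 0ℤ :* v :+ (con 0ℤ :* w :+ (con 0ℤ :* h :+ con 0ℤ))) :+ con 0ℤ :=
        m :* u) refl m (y 0F) (y 1F) (y 2F) (y 3F)
      evaluate y 2F = solve 5 (λ m u v w h →
        con 0ℤ :* u :+ (m :* v :+ (con 0ℤ :* w :+ (con 0ℤ :* h :+ con 0ℤ))) :+ con 0ℤ :=
        m :* v) refl m (y 0F) (y 1F) (y 2F) (y 3F)
      evaluate y 3F = solve 5 (λ n u v w h →
        con 0ℤ :* u :+ (con 0ℤ :* v :+ (con -1ℤ :* w :+ (n :* h :+ con 0ℤ))) :+ con 0ℤ :=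
        n :* h :- w) refl n (y 0F) (y 1F) (y 2F) (y 3F)
      evaluate y 4F = solve 4 (λ u v w h →
        con 0ℤ :* u :+ (con 0ℤ :* v :+ (con 1ℤ :* w :+ (con 0ℤ :* h :+ con 0ℤ))) :+ con 0ℤ :=
        w) refl (y 0F) (y 1F) (y 2F) (y 3F)

    from-sum : ∀ y → sum (apply from y) ≈ n
    from-sum y = trans (sum-cong-≋ (from-coordinates {y} {y} λ _ → refl)) (solve 6 (λ m n u v w h →
      (:- m :* (u :+ v) :+ :- n :* h :+ n) :+
        (m :* u :+ (m :* v :+ (n :* h :- w :+ (w :+ con 0ℤ)))) := n)
      refl m n (y 0F) (y 1F) (y 2F) (y 3F))

    from∘to : ∀ x → sum x ≈ n → apply from (apply to x) ≋ x
    from∘to x Σx≈n i = trans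
      (from-coordinates {apply to x} {toCoordinates x} (to-coordinates {x} {x} (λ _ → refl)) i)
      (e i)
      where
      e : fromCoordinates (toCoordinates x) ≋ x
      e 0F = begin
        - m * (two * k * x 1F + two * k * x 2F) + - n * (k * (x 3F + x 4F)) + n
          ≈⟨ solve 5 (λ m n a b c → :- m :* (a :+ b) :+ :- n :* c :+ n :=
               :- (m :* a) :- m :* b :- n :* c :+ n) refl m n
               (two * k * x 1F) (two * k * x 2F) (k * (x 3F + x 4F)) ⟩
        - (m * (two * k * x 1F)) - m * (two * k * x 2F) - n * (k * (x 3F + x 4F)) + n
          ≈⟨ +-cong (+-cong (+-cong (-‿cong (m2ka≈a (x 1F))) (-‿cong (m2ka≈a (x 2F))))
               (-‿cong (nka≈a (x 3F + x 4F)))) (sym Σx≈n) ⟩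
        - x 1F - x 2F - (x 3F + x 4F) + sum x
          ≈⟨ solve 5 (λ x₀ x₁ x₂ x₃ x₄ → :- x₁ :- x₂ :- (x₃ :+ x₄) :+
               (x₀ :+ (x₁ :+ (x₂ :+ (x₃ :+ (x₄ :+ con 0ℤ))))) := x₀)
               refl (x 0F) (x 1F) (x 2F) (x 3F) (x 4F) ⟩
        x 0F ∎
      e 1F = m2ka≈a (x 1F)
      e 2F = m2ka≈a (x 2F)
      e 3F = begin
        n * (k * (x 3F + x 4F)) - x 4F       ≈⟨ +-congʳ (nka≈a (x 3F + x 4F)) ⟩
        x 3F + x 4F - x 4F                   ≈⟨ solve 2 (λ a b → a :+ b :- b := a) refl (x 3F) (x 4F) ⟩
        x 3F                                 ∎
      e 4F = refl

    to∘from : ∀ y → apply to (apply from y) ≋ y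
    to∘from y i = trans
      (to-coordinates {apply from y} {fromCoordinates y} (from-coordinates {y} {y} (λ _ → refl)) i)
      (e i)
      where
      e : toCoordinates (fromCoordinates y) ≋ y
      e 0F = 2kma≈a (y 0F)
      e 1F = 2kma≈a (y 1F)
      e 2F = refl
      e 3F = begin
        k * (n * y 3F - y 2F + y 2F)   ≈⟨ *-congˡ (solve 2 (λ a b → a :- b :+ b := a) refl (n * y 3F) (y 2F)) ⟩
        k * (n * y 3F)                 ≈⟨ kna≈a (y 3F) ⟩
        y 3F                           ∎

    to-ι : ∀ {x z} → x ≋ map ι z → C₀-Lattice z → ℤ^ 4 (apply to x)
    to-ι {x} {z} x≋z (u , v , w , h , z₁≡mu , z₂≡mv , _ , z₃+z₄≡nh) =
      u ∷ v ∷ z 4F ∷ h ∷ [] , λ i → trans (to-coordinates {x} {map ι z} x≋z i) (e i)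
      where
      divide : ∀ {z} y → z ≡ + M ℤ.* y → two * k * ι z ≈ ι y
      divide y ≡.refl = trans (*-congˡ (ι-* (+ M) y)) (2kma≈a (ι y))
      e : toCoordinates (map ι z) ≋ map ι (u ∷ v ∷ z 4F ∷ h ∷ [])
      e 0F = divide u z₁≡mu
      e 1F = divide v z₂≡mv
      e 2F = refl
      e 3F = begin
        k * (ι (z 3F) + ι (z 4F))   ≈⟨ *-congˡ (ι-+ (z 3F) (z 4F)) ⟨
        k * ι (z 3F ℤ.+ z 4F)       ≡⟨ ≡.cong (λ z → k * ι z) z₃+z₄≡nh ⟩
        k * ι (+ N ℤ.* h)           ≈⟨ *-congˡ (ι-* (+ N) h) ⟩
        k * (n * ι h)               ≈⟨ kna≈a (ι h) ⟩
        ι h                         ∎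

    from-ι : ∀ {x y} → x ≋ map ι y → apply from x ≋ map ι (joinWord y)
    from-ι {x} {y} x≋y i = begin
      sum (λ j → ι (a j) * x j) + ι b            ≈⟨ +-congʳ (sum-cong-≋ (λ j →
        trans (*-congˡ (x≋y j)) (sym (ι-* (a j) (y j))))) ⟩
      sum (λ j → ι (a j ℤ.* y j)) + ι b          ≈⟨ +-congʳ (ι-sum (λ j → a j ℤ.* y j)) ⟨
      ι (sumℤ (λ j → a j ℤ.* y j)) + ι b         ≈⟨ ι-+ (sumℤ (λ j → a j ℤ.* y j)) b ⟨
      ι (joinWord y i)                              ∎
      where
      a = joinMatrix i
      b = joinTranslation i

    bottomPoint : Vector ℤ 2 → Point 4
    bottomPoint u = (map ι u ++ replicate 1 0#) ++ (0# ∷ [])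

    topPoint : Vector ℤ 1 → Point 4
    topPoint v = (replicate 2 0# ++ map ι v) ++ (1# ∷ [])

    triangleVertices : Vector (Vector ℤ 2) 3
    triangleVertices = (+ 0 ∷ + 0 ∷ []) ∷ (+ 2 ∷ + 0 ∷ []) ∷ (+ 0 ∷ + 2 ∷ []) ∷ []

    intervalVertices : Vector (Vector ℤ 1) 2
    intervalVertices = (+ 0 ∷ []) ∷ (+ N ∷ []) ∷ []

    Triangle : Pred (Point 2) ℓ₁
    Triangle = range (map (map ι) triangleVertices)

    Interval : Pred (Point 1) ℓ₁
    Interval = range (map (map ι) intervalVertices)

    joinVertices : Vector (Point 4) 5
    joinVertices = map bottomPoint triangleVertices ++ map topPoint intervalVertices

    to-body : ∀ {x} → x ∈ conv (scaledSimplex 5 N) →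
              apply to x ∈ LatticeBody.body (freeJoin 2Δ₂ (interval N))
    to-body {x} x∈ = 5 , joinVertices , map (k *_) x , (λ where
        0F → inj₁ (_ , ⊆conv Triangle (0F , λ _ → refl) , λ _ → refl)
        1F → inj₁ (_ , ⊆conv Triangle (1F , λ _ → refl) , λ _ → refl)
        2F → inj₁ (_ , ⊆conv Triangle (2F , λ _ → refl) , λ _ → refl)
        3F → inj₂ (_ , ⊆conv Interval (0F , λ _ → refl) , λ _ → refl)
        4F → inj₂ (_ , ⊆conv Interval (1F , λ _ → refl) , λ _ → refl)) ,
      (λ i → *-nonneg 0≤k (conv-scaledSimplex-nonneg N x∈ i)) ,
      barycentric-sum {N = N} nk≈1 {x} (aff-scaledSimplex-sum N (conv⊆aff (scaledSimplex 5 N) x∈)) ,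
      λ i → trans (to-coordinates {x} {x} (λ _ → refl) i) (e i)
      where
      e : toCoordinates x ≋ combination (map (k *_) x) joinVertices
      e 0F = solve 6 (λ k x₀ x₁ x₂ x₃ x₄ → con (+ 2) :* k :* x₁ :=
        k :* x₀ :* con 0ℤ :+ (k :* x₁ :* con (+ 2) :+ (k :* x₂ :* con 0ℤ :+
          (k :* x₃ :* con 0ℤ :+ (k :* x₄ :* con 0ℤ :+ con 0ℤ)))))
        refl k (x 0F) (x 1F) (x 2F) (x 3F) (x 4F)
      e 1F = solve 6 (λ k x₀ x₁ x₂ x₃ x₄ → con (+ 2) :* k :* x₂ :=
        k :* x₀ :* con 0ℤ :+ (k :* x₁ :* con 0ℤ :+ (k :* x₂ :* con (+ 2) :+
          (k :* x₃ :* con 0ℤ :+ (k :* x₄ :* con 0ℤ :+ con 0ℤ)))))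
        refl k (x 0F) (x 1F) (x 2F) (x 3F) (x 4F)
      e 2F = trans (sym (nka≈a (x 4F))) (solve 7 (λ n k x₀ x₁ x₂ x₃ x₄ → n :* (k :* x₄) :=
        k :* x₀ :* con 0ℤ :+ (k :* x₁ :* con 0ℤ :+ (k :* x₂ :* con 0ℤ :+
          (k :* x₃ :* con 0ℤ :+ (k :* x₄ :* n :+ con 0ℤ)))))
        refl n k (x 0F) (x 1F) (x 2F) (x 3F) (x 4F))
      e 3F = trans (sym (*-identityʳ _)) (solve 7 (λ o k x₀ x₁ x₂ x₃ x₄ → k :* (x₃ :+ x₄) :* o :=
        k :* x₀ :* con 0ℤ :+ (k :* x₁ :* con 0ℤ :+ (k :* x₂ :* con 0ℤ :+
          (k :* x₃ :* o :+ (k :* x₄ :* o :+ con 0ℤ)))))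
        refl 1# k (x 0F) (x 1F) (x 2F) (x 3F) (x 4F))

    nonneg-≈ : ∀ {x y} → x ≈ y → 0# ≤ y → 0# ≤ x
    nonneg-≈ x≈y = ≤-resp-≈ refl (sym x≈y)

    2Δ₂-nonneg : ∀ j {u} → u ∈ 2Δ₂ → 0# ≤ u j
    2Δ₂-nonneg 0F = affine-conv-nonneg Triangle (affine-coordinate 0F) λ where
      (0F , p≋) → nonneg-≈ (p≋ 0F) (ι-nonneg 0)
      (1F , p≋) → nonneg-≈ (p≋ 0F) (ι-nonneg 2)
      (2F , p≋) → nonneg-≈ (p≋ 0F) (ι-nonneg 0)
    2Δ₂-nonneg 1F = affine-conv-nonneg Triangle (affine-coordinate 1F) λ where
      (0F , p≋) → nonneg-≈ (p≋ 1F) (ι-nonneg 0)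
      (1F , p≋) → nonneg-≈ (p≋ 1F) (ι-nonneg 0)
      (2F , p≋) → nonneg-≈ (p≋ 1F) (ι-nonneg 2)

    2Δ₂-sum≤2 : ∀ {u} → u ∈ 2Δ₂ → 0# ≤ n + - m * (u 0F + u 1F)
    2Δ₂-sum≤2 = affine-conv-nonneg Triangle
      (affine-+ (affine-const n) (affine-* (- m)
        (affine-+ (affine-coordinate 0F) (affine-coordinate 1F))))
      λ where
        (0F , p≋) → nonneg-≈ (at p≋) (nonneg-≈
          (solve 2 (λ m n → n :+ :- m :* (con 0ℤ :+ con 0ℤ) := n) refl m n) (ι-nonneg N))
        (1F , p≋) → nonneg-≈ (trans (at p≋) (+-congʳ n≈m*2)) (nonneg-≈
          (solve 1 (λ m → m :* con (+ 2) :+ :- m :* (con (+ 2) :+ con 0ℤ) := con 0ℤ) refl m) ≤-refl)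
        (2F , p≋) → nonneg-≈ (trans (at p≋) (+-congʳ n≈m*2)) (nonneg-≈
          (solve 1 (λ m → m :* con (+ 2) :+ :- m :* (con 0ℤ :+ con (+ 2)) := con 0ℤ) refl m) ≤-refl)
      where
      at : ∀ {p q : Point 2} → p ≋ q → n + - m * (p 0F + p 1F) ≈ n + - m * (q 0F + q 1F)
      at p≋q = +-congˡ (*-congˡ (+-cong (p≋q 0F) (p≋q 1F)))

    interval-nonneg : ∀ {v} → v ∈ interval N → 0# ≤ v 0F
    interval-nonneg = affine-conv-nonneg Interval (affine-coordinate 0F) λ where
      (0F , p≋) → nonneg-≈ (p≋ 0F) (ι-nonneg 0)
      (1F , p≋) → nonneg-≈ (p≋ 0F) (ι-nonneg N)

    interval≤N : ∀ {v} → v ∈ interval N → 0# ≤ n + - 1# * v 0F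
    interval≤N = affine-conv-nonneg Interval
      (affine-+ (affine-const n) (affine-* (- 1#) (affine-coordinate 0F))) λ where
        (0F , p≋) → nonneg-≈ (+-congˡ (*-congˡ (p≋ 0F))) (nonneg-≈
          (solve 2 (λ o n → n :+ :- o :* con 0ℤ := n) refl 1# n) (ι-nonneg N))
        (1F , p≋) → nonneg-≈ (+-congˡ (*-congˡ (p≋ 0F))) (nonneg-≈
          (trans (+-congˡ (-1*x≈-x n)) (-‿inverseʳ n)) ≤-refl)

    from-nonneg : ∀ {y} → y ∈ LatticeBody.body (freeJoin 2Δ₂ (interval N)) →
                  ∀ i → 0# ≤ apply from y i
    from-nonneg (_ , p , _ , p∈ , t≥0 , Σt≈1 , y≋) i =
      affine-nonneg (affine-apply from i) {p = p} t≥0 Σt≈1 y≋ λ j → case p∈ j of λ where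
        (inj₁ (u , u∈ , p≋)) → nonneg-≈ (from-coordinates {p j} p≋ i) (bottom u∈ i)
        (inj₂ (v , v∈ , p≋)) → nonneg-≈ (from-coordinates {p j} p≋ i) (top v∈ i)
      where
      bottom : ∀ {u} → u ∈ 2Δ₂ →
        ∀ i → 0# ≤ fromCoordinates ((u ++ replicate 1 0#) ++ (0# ∷ [])) i
      bottom {u} u∈ 0F = nonneg-≈ (solve 4 (λ m n u₀ u₁ →
        :- m :* (u₀ :+ u₁) :+ :- n :* con 0ℤ :+ n := n :+ :- m :* (u₀ :+ u₁))
        refl m n (u 0F) (u 1F)) (2Δ₂-sum≤2 u∈)
      bottom u∈ 1F = *-nonneg (ι-nonneg M) (2Δ₂-nonneg 0F u∈)
      bottom u∈ 2F = *-nonneg (ι-nonneg M) (2Δ₂-nonneg 1F u∈)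
      bottom u∈ 3F = nonneg-≈
        (solve 1 (λ n → n :* con 0ℤ :- con 0ℤ := con 0ℤ) refl n) ≤-refl
      bottom u∈ 4F = ≤-refl
      top : ∀ {v} → v ∈ interval N →
        ∀ i → 0# ≤ fromCoordinates ((replicate 2 0# ++ v) ++ (1# ∷ [])) i
      top v∈ 0F = nonneg-≈ (trans (+-congˡ (sym (*-identityʳ n))) (solve 3 (λ m n o →
        :- m :* (con 0ℤ :+ con 0ℤ) :+ :- n :* o :+ n :* o := con 0ℤ) refl m n 1#)) ≤-refl
      top v∈ 1F = nonneg-≈ (zeroʳ m) ≤-refl
      top v∈ 2F = nonneg-≈ (zeroʳ m) ≤-refl
      top v∈ 3F = nonneg-≈ (+-cong (*-identityʳ n) (sym (-1*x≈-x _))) (interval≤N v∈)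
      top v∈ 4F = interval-nonneg v∈


  simplex≅freeJoin : (C : Code N 5) (z : ZeroSum C) → ⟦ C ⟧ ≐ ⟦ C₀ ⟧ →
                     simplex C z ≅ᵤ freeJoin 2Δ₂ (interval N)
  simplex≅freeJoin C z (C⊆C₀ , C₀⊆C) = record
    { to           = to
    ; from         = from
    ; to-lattice   = λ { x (_ , w , w∈C , x≋) →
        lift (to-ι {x} {w} x≋ (C₀⇒lattice {w} (C⊆C₀ {w} w∈C))) }
    ; from-lattice = λ { y (lift (w , y≋)) → sum⇒aff {N = N} nk≈1 (from-sum y) ,
        joinWord w , C₀⊆C {joinWord w} (lattice⇒C₀ {joinWord w} (joinWord-lattice w)) ,
        from-ι {y} {w} y≋ }
    ; from∘to      = λ { x (x∈aff , _) → from∘to x (aff-scaledSimplex-sum N x∈aff) }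
    ; to∘from      = λ y _ → to∘from y
    ; to-body      = λ _ → to-body
    ; from-body    = λ y y∈ → nonneg⇒conv {N = N} nk≈1 (from-sum y) 0≤k (from-nonneg y∈)
    }

open import Data.Nat.Base using (_≤_; _/_)
open import Data.Nat.Divisibility using (_∣_)

lemma3p10 : ∀ {c ℓ₁ ℓ₂ ℓ₃} (K : OrderedField c ℓ₁ ℓ₂ ℓ₃)
    (N : ℕ) → 2 ≤ N → 2 ∣ N →
    (a : ℤ) → ¬ (+ 2 ∣ᶻ a) →
    let open Geometry K
        M₂ = + (N / 2)
        C = span (ℤ/ N) (g M₂ a)
        C₀ = span (ℤ/ N) (g₀ M₂)
        C₁ = span (ℤ/ 2) block₁
        C₂ = span (ℤ/ N) block₂
    in
    (C ≅ C₀)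
    × (Σ[ e ∈ lcm 2 N ≡ N ] ⟦ C₀ ⟧ ≐ ⟦ subst (λ L → Code L 5) e (C₁ ⊕ C₂) ⟧)
    × (Σ[ z ∈ ZeroSum C ] simplex C z ≅ᵤ freeJoin 2Δ₂ (interval N))
    × (Σ[ z ∈ ZeroSum C₀ ] simplex C₀ z ≅ᵤ freeJoin 2Δ₂ (interval N))
lemma3p10 K N@(suc _) _ 2∣N a 2∤a =
  (idₚ , λ x → mk⇔ (C⊆C₀ {x}) (C₀⊆C {x})) ,
  (lcm[2,N]≡N , C₀≐⊕) ,
  (C-zeroSum , simplex≅freeJoin C C-zeroSum ((λ {x} → C⊆C₀ {x}) , λ {x} → C₀⊆C {x})) ,
  (C₀-zeroSum , simplex≅freeJoin C₀ C₀-zeroSum ((λ p → p) , (λ p → p)))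
  where
  N≡[N/2]*2 : N ≡ N / 2 ℕ.* 2
  N≡[N/2]*2 = ≡.sym (ℕ%.m/n*n≡m 2∣N)
  open EvenModulus N (N / 2) N≡[N/2]*2
  open SimplexIsomorphism K N (N / 2) N≡[N/2]*2
  C = span (ℤ/ N) (g (+ (N / 2)) a)
  C⊆C₀ : ⟦ C ⟧ ⊆ ⟦ C₀ ⟧
  C⊆C₀ {x} = g⊆g₀ a {x}
  C₀⊆C : ⟦ C₀ ⟧ ⊆ ⟦ C ⟧
  C₀⊆C {x} = let (b , a≡1+2b) = odd⇒≡1+[b*2] a 2∤a in g₀⊆g a b a≡1+2b {x}
  C-zeroSum : ZeroSum C
  C-zeroSum x x∈C = C₀-zeroSum x (C⊆C₀ {x} x∈C)
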